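{- Let $n \in \mathbb{N}^*$ and, for a natural number $a$, let $$f_a(\mathbf{x}) = (a-1)\prod_{i=1}^n\left(\frac{x_i+1}{2}\right)+1 \in \mathbb{R}[x_1,\dots,x_n].$$ For every $a > \frac{2^n-1}{2^{n-2}-1}$ we have $f_a \notin S_d$ for all $d \in \mathbb{N}$, where $$S_d = \left\{\sum_{\text{finite}} s\cdot h \ :\ s \in C_{n,2d},\ h \in \{1,\ \pm(x_i^2-1),\ 1+c_i\pm x_i \ :\ i\in[n],\ c_i \in \mathbb{R}_{\ge 0}\}\right\}.$$
   Context: $\mathbb{N}$ contains $0$, $\mathbb{N}^* = \mathbb{N}\setminus\{0\}$, and $[n]=\{1,\dots,n\}$. A circuit polynomial is a polynomial $f(\mathbf{x}) = \sum_{j=0}^r f_{\boldsymbol{\alpha}(j)} \mathbf{x}^{\boldsymbol{\alpha}(j)} + f_{\boldsymbol{\beta}} \mathbf{x}^{\boldsymbol{\beta}}$ in $\mathbb{R}[x_1,\dots,x_n]$ with $r \le n$, exponents $\boldsymbol{\alpha}(j),\boldsymbol{\beta} \in \mathbb{N}^n$, $f_{\boldsymbol{\alpha}(j)} > 0$, $f_{\boldsymbol{\beta}} \in \mathbb{R}$, such that the Newton polytope of $f$ is a simplex with vertices $\boldsymbol{\alpha}(0),\dots,\boldsymbol{\alpha}(r) \in (2\mathbb{N})^n$ and $\boldsymbol{\beta}$ lies in the (relative) interior of this simplex. Monomial squares $c\,\mathbf{x}^{\boldsymbol{\alpha}}$ with $c>0$ and $\boldsymbol{\alpha} \in (2\mathbb{N})^n$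 count as nonnegative circuit polynomials. A circuit polynomial is nonnegative if it is nonnegative on all of $\mathbb{R}^n$. $C_{n,2d}$ is the set of SONC polynomials (sums of nonnegative circuit polynomials) in $n$ variables of degree at most $2d$: all polynomials $\sum_{i=1}^k \mu_i q_i$ of degree at most $2d$ with $k\in\mathbb{N}^*$, $\mu_i \ge 0$ and $q_i$ nonnegative circuit polynomials.
   Formalization: The claim is proved for n ≥ 3 instead of all n ≥ 1: for n = 2 the bound (2^n−1)/(2^{n−2}−1) has denominator zero, and for n = 1 the bound is −2 and the claim is false, since f_a = (a/2)(1+x) + (1/2)(1−x) lies in every S_d. -}

module Defs where

open import Level using (0ℓ)
open import Algebra.Bundles using (CommutativeMonoid; RawRing)
import Algebra.Definitions.RawSemiring as RawSemiringDefs
import Algebra.Properties.CommutativeSemigroup as CommutativeSemigroupProperties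
import Algebra.Properties.Ring as RingProperties
open import Data.Bool.Base using (if_then_else_)
open import Data.Fin.Base using (Fin)
open import Data.Integer.Base using (+_)
open import Data.List.Base using (List; []; _∷_; _++_; map; cartesianProductWith)
open import Data.Nat.Base as ℕ using (ℕ; suc; s≤s; _⊔_; _∸_)
import Data.Nat.Properties as ℕ
open import Data.Nat.Divisibility using (_∣_)
open import Data.Product.Base using (Σ; ∃-syntax; _×_; _,_)
open import Data.Rational using (ℚ; 0ℚ; 1ℚ; ½; ∣_∣; Positive; positive)
import Data.Rational as ℚ
import Data.Rational.Properties as ℚ
open import Data.Sum.Base using (_⊎_)
open import Data.Vec.Base as Vec using (Vec)
import Data.Vec.Properties as Vec
open import Data.Vec.Functional using (Vector)
open import Relation.Binary.PropositionalEquality using (_≡_; refl; sym; trans; cong; cong₂; subst)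
open import Relation.Nullary using (¬_; does)
open import Relation.Unary using (Pred; _∈_; _≐_)

-- ℝ is the set of Cauchy sequences of rationals, considered up to _≃_;
-- the operations are pointwise.

IsCauchy : (ℕ → ℚ) → Set
IsCauchy x = ∀ ε → 0ℚ ℚ.< ε →
  ∃[ N ] (∀ m n → N ℕ.≤ m → N ℕ.≤ n → ∣ x m ℚ.- x n ∣ ℚ.< ε)

record ℝ : Set where
  constructor mkℝ
  field
    seq    : ℕ → ℚ
    cauchy : IsCauchy seq
open ℝ public

infix 4 _≃_ _≄_ _≤ᴿ_ _<ᴿ_

record _≃_ (x y : ℝ) : Set where
  constructor mk≃
  field close : ∀ ε → 0ℚ ℚ.< ε →
          ∃[ N ] (∀ n → N ℕ.≤ n → ∣ seq x n ℚ.- seq y n ∣ ℚ.< ε)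

record _≤ᴿ_ (x y : ℝ) : Set where
  constructor mk≤
  field below : ∀ ε → 0ℚ ℚ.< ε →
          ∃[ N ] (∀ n → N ℕ.≤ n → seq x n ℚ.≤ seq y n ℚ.+ ε)

record _<ᴿ_ (x y : ℝ) : Set where
  constructor mk<
  field
    gap   : ℚ
    gap>0   : 0ℚ ℚ.< gap
    apart : ∃[ N ] (∀ n → N ℕ.≤ n → seq x n ℚ.+ gap ℚ.≤ seq y n)

_≄_ : ℝ → ℝ → Set
x ≄ y = ¬ (x ≃ y)

open CommutativeSemigroupProperties
  (CommutativeMonoid.commutativeSemigroup ℚ.+-0-commutativeMonoid) using (interchange)
open RingProperties ℚ.+-*-ring using (x[y-z]≈xy-xz; [y-z]x≈yx-zx)

-- abstract, so that normalising a real never unfolds its modulus of convergence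
abstract
  minus-+ : ∀ a b c d → (a ℚ.+ b) ℚ.- (c ℚ.+ d) ≡ (a ℚ.- c) ℚ.+ (b ℚ.- d)
  minus-+ a b c d =
    trans (cong (a ℚ.+ b ℚ.+_) (ℚ.neg-distrib-+ c d)) (interchange a b (ℚ.- c) (ℚ.- d))

  cancel : ∀ a b → b ℚ.+ (a ℚ.- b) ≡ a
  cancel a b = let open ℚ.≤-Reasoning in begin-equality
    b ℚ.+ (a ℚ.- b)    ≡⟨ ℚ.+-comm b (a ℚ.- b) ⟩
    a ℚ.- b ℚ.+ b      ≡⟨ ℚ.+-assoc a (ℚ.- b) b ⟩
    a ℚ.+ (ℚ.- b ℚ.+ b) ≡⟨ cong (a ℚ.+_) (ℚ.+-inverseˡ b) ⟩
    a ℚ.+ 0ℚ           ≡⟨ ℚ.+-identityʳ a ⟩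
    a                  ∎

  telescope : ∀ a b c → (a ℚ.- b) ℚ.+ (b ℚ.- c) ≡ a ℚ.- c
  telescope a b c = let open ℚ.≤-Reasoning in begin-equality
    (a ℚ.- b) ℚ.+ (b ℚ.- c)  ≡⟨ ℚ.+-assoc (a ℚ.- b) b (ℚ.- c) ⟨
    (a ℚ.- b) ℚ.+ b ℚ.- c    ≡⟨ cong (ℚ._- c) (trans (ℚ.+-comm (a ℚ.- b) b) (cancel a b)) ⟩
    a ℚ.- c                  ∎

  minus-* : ∀ a b c d → a ℚ.* b ℚ.- c ℚ.* d ≡ a ℚ.* (b ℚ.- d) ℚ.+ d ℚ.* (a ℚ.- c)
  minus-* a b c d = sym (let open ℚ.≤-Reasoning in begin-equality
    a ℚ.* (b ℚ.- d) ℚ.+ d ℚ.* (a ℚ.- c)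
      ≡⟨ cong (a ℚ.* (b ℚ.- d) ℚ.+_) (ℚ.*-comm d (a ℚ.- c)) ⟩
    a ℚ.* (b ℚ.- d) ℚ.+ (a ℚ.- c) ℚ.* d
      ≡⟨ cong₂ ℚ._+_ (x[y-z]≈xy-xz a b d) ([y-z]x≈yx-zx d a c) ⟩
    (a ℚ.* b ℚ.- a ℚ.* d) ℚ.+ (a ℚ.* d ℚ.- c ℚ.* d)
      ≡⟨ telescope (a ℚ.* b) (a ℚ.* d) (c ℚ.* d) ⟩
    a ℚ.* b ℚ.- c ℚ.* d ∎)

  half-pos : ∀ ε → 0ℚ ℚ.< ε → 0ℚ ℚ.< ½ ℚ.* ε
  half-pos ε ε>0 = ℚ.positive⁻¹ (½ ℚ.* ε) {{ℚ.pos*pos⇒pos ½ ε {{positive ε>0}}}}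

  halves : ∀ ε → ½ ℚ.* ε ℚ.+ ½ ℚ.* ε ≡ ε
  halves ε = let open ℚ.≤-Reasoning in begin-equality
    ½ ℚ.* ε ℚ.+ ½ ℚ.* ε  ≡⟨ ℚ.*-distribʳ-+ ε ½ ½ ⟨
    1ℚ ℚ.* ε             ≡⟨ ℚ.*-identityˡ ε ⟩
    ε                    ∎

  const-cauchy : ∀ q → IsCauchy (λ _ → q)
  const-cauchy q ε ε>0 = 0 , λ _ _ _ _ →
    subst (ℚ._< ε) (sym (cong ∣_∣ (ℚ.+-inverseʳ q))) ε>0

  +-cauchy : ∀ x y → IsCauchy x → IsCauchy y → IsCauchy (λ n → x n ℚ.+ y n)
  +-cauchy x y cx cy ε ε>0
    with M , close-x ← cx (½ ℚ.* ε) (half-pos ε ε>0)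
       | N , close-y ← cy (½ ℚ.* ε) (half-pos ε ε>0)
    = M ⊔ N , λ m n ≤m ≤n → let open ℚ.≤-Reasoning in begin-strict
      ∣ (x m ℚ.+ y m) ℚ.- (x n ℚ.+ y n) ∣
        ≡⟨ cong ∣_∣ (minus-+ (x m) (y m) (x n) (y n)) ⟩
      ∣ (x m ℚ.- x n) ℚ.+ (y m ℚ.- y n) ∣
        ≤⟨ ℚ.∣p+q∣≤∣p∣+∣q∣ (x m ℚ.- x n) (y m ℚ.- y n) ⟩
      ∣ x m ℚ.- x n ∣ ℚ.+ ∣ y m ℚ.- y n ∣
        <⟨ ℚ.+-mono-< (close-x m n (ℕ.m⊔n≤o⇒m≤o M N ≤m) (ℕ.m⊔n≤o⇒m≤o M N ≤n))
                      (close-y m n (ℕ.m⊔n≤o⇒n≤o M N ≤m) (ℕ.m⊔n≤o⇒n≤o M N ≤n)) ⟩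
      ½ ℚ.* ε ℚ.+ ½ ℚ.* ε
        ≡⟨ halves ε ⟩
      ε ∎

  neg-cauchy : ∀ x → IsCauchy x → IsCauchy (λ n → ℚ.- x n)
  neg-cauchy x cx ε ε>0 with N , close ← cx ε ε>0
    = N , λ m n ≤m ≤n → subst (ℚ._< ε) (sym (flip m n)) (close m n ≤m ≤n)
    where
    open ℚ.≤-Reasoning
    flip : ∀ m n → ∣ ℚ.- x m ℚ.- ℚ.- x n ∣ ≡ ∣ x m ℚ.- x n ∣
    flip m n = begin-equality
      ∣ ℚ.- x m ℚ.- ℚ.- x n ∣
        ≡⟨ cong ∣_∣ (sym (ℚ.neg-distrib-+ (x m) (ℚ.- x n))) ⟩
      ∣ ℚ.- (x m ℚ.- x n) ∣
        ≡⟨ ℚ.∣-p∣≡∣p∣ (x m ℚ.- x n) ⟩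
      ∣ x m ℚ.- x n ∣ ∎

  bounded : ∀ x → IsCauchy x →
    ∃[ K ] (Positive K × ∃[ N ] (∀ n → N ℕ.≤ n → ∣ x n ∣ ℚ.≤ K))
  bounded x cx with N , close ← cx 1ℚ (ℚ.positive⁻¹ 1ℚ)
    = ∣ x N ∣ ℚ.+ 1ℚ
    , ℚ.nonNeg+pos⇒pos ∣ x N ∣ {{ℚ.nonNegative (ℚ.0≤∣p∣ (x N))}} 1ℚ
    , N , λ n ≤n → let open ℚ.≤-Reasoning in begin
      ∣ x n ∣
        ≡⟨ cong ∣_∣ (sym (cancel (x n) (x N))) ⟩
      ∣ x N ℚ.+ (x n ℚ.- x N) ∣
        ≤⟨ ℚ.∣p+q∣≤∣p∣+∣q∣ (x N) (x n ℚ.- x N) ⟩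
      ∣ x N ∣ ℚ.+ ∣ x n ℚ.- x N ∣
        ≤⟨ ℚ.+-monoʳ-≤ ∣ x N ∣ (ℚ.<⇒≤ (close n N ≤n ℕ.≤-refl)) ⟩
      ∣ x N ∣ ℚ.+ 1ℚ ∎

  *-close : ∀ ε K → 0ℚ ℚ.< ε → Positive K →
    ∃[ δ ] (0ℚ ℚ.< δ × K ℚ.* δ ≡ ½ ℚ.* ε)
  *-close ε K ε>0 K>0
    = ½ ℚ.* ε ℚ.* K⁻¹
    , ℚ.positive⁻¹ (½ ℚ.* ε ℚ.* K⁻¹) {{ℚ.pos*pos⇒pos (½ ℚ.* ε) {{positive (half-pos ε ε>0)}}
                                      K⁻¹ {{ℚ.1/pos⇒pos K {{K>0}}}}}}
    , (begin-equality
      K ℚ.* (½ ℚ.* ε ℚ.* K⁻¹)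
        ≡⟨ ℚ.*-comm K (½ ℚ.* ε ℚ.* K⁻¹) ⟩
      ½ ℚ.* ε ℚ.* K⁻¹ ℚ.* K
        ≡⟨ ℚ.*-assoc (½ ℚ.* ε) K⁻¹ K ⟩
      ½ ℚ.* ε ℚ.* (K⁻¹ ℚ.* K)
        ≡⟨ cong (½ ℚ.* ε ℚ.*_) (ℚ.*-inverseˡ K {{K≢0}}) ⟩
      ½ ℚ.* ε ℚ.* 1ℚ
        ≡⟨ ℚ.*-identityʳ (½ ℚ.* ε) ⟩
      ½ ℚ.* ε ∎)
    where
    open ℚ.≤-Reasoning
    K≢0 : ℚ.NonZero K
    K≢0 = ℚ.pos⇒nonZero K {{K>0}}
    K⁻¹ : ℚ
    K⁻¹ = (ℚ.1/ K) {{K≢0}}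

  *-bound : ∀ p q K δ → Positive K → ∣ p ∣ ℚ.≤ K → ∣ q ∣ ℚ.< δ → ∣ p ℚ.* q ∣ ℚ.< K ℚ.* δ
  *-bound p q K δ K>0 p≤K q<δ = begin-strict
    ∣ p ℚ.* q ∣       ≡⟨ ℚ.∣p*q∣≡∣p∣*∣q∣ p q ⟩
    ∣ p ∣ ℚ.* ∣ q ∣   ≤⟨ ℚ.*-monoʳ-≤-nonNeg ∣ q ∣ {{ℚ.nonNegative (ℚ.0≤∣p∣ q)}} p≤K ⟩
    K ℚ.* ∣ q ∣       <⟨ ℚ.*-monoʳ-<-pos K {{K>0}} q<δ ⟩
    K ℚ.* δ           ∎
    where open ℚ.≤-Reasoning

  *-estimate : ∀ a b c d {K L δ η ε} → Positive K → Positive L →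
    K ℚ.* δ ≡ ½ ℚ.* ε → L ℚ.* η ≡ ½ ℚ.* ε →
    ∣ a ∣ ℚ.≤ K → ∣ b ℚ.- d ∣ ℚ.< δ → ∣ d ∣ ℚ.≤ L → ∣ a ℚ.- c ∣ ℚ.< η →
    ∣ a ℚ.* b ℚ.- c ℚ.* d ∣ ℚ.< ε
  *-estimate a b c d {K} {L} {δ} {η} {ε} K>0 L>0 Kδ≡ Lη≡ a≤K b≈d d≤L a≈c = begin-strict
    ∣ a ℚ.* b ℚ.- c ℚ.* d ∣
      ≡⟨ cong ∣_∣ (minus-* a b c d) ⟩
    ∣ a ℚ.* (b ℚ.- d) ℚ.+ d ℚ.* (a ℚ.- c) ∣
      ≤⟨ ℚ.∣p+q∣≤∣p∣+∣q∣ (a ℚ.* (b ℚ.- d)) (d ℚ.* (a ℚ.- c)) ⟩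
    ∣ a ℚ.* (b ℚ.- d) ∣ ℚ.+ ∣ d ℚ.* (a ℚ.- c) ∣
      <⟨ ℚ.+-mono-< {∣ a ℚ.* (b ℚ.- d) ∣} {K ℚ.* δ} {∣ d ℚ.* (a ℚ.- c) ∣} {L ℚ.* η}
           (*-bound a (b ℚ.- d) K δ K>0 a≤K b≈d) (*-bound d (a ℚ.- c) L η L>0 d≤L a≈c) ⟩
    K ℚ.* δ ℚ.+ L ℚ.* η
      ≡⟨ cong₂ ℚ._+_ Kδ≡ Lη≡ ⟩
    ½ ℚ.* ε ℚ.+ ½ ℚ.* ε
      ≡⟨ halves ε ⟩
    ε ∎
    where open ℚ.≤-Reasoning

  *-cauchy : ∀ x y → IsCauchy x → IsCauchy y → IsCauchy (λ n → x n ℚ.* y n)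
  *-cauchy x y cx cy ε ε>0 =
    let K , K>0 , A , bound-x = bounded x cx
        L , L>0 , B , bound-y = bounded y cy
        δ , δ>0 , Kδ≡ = *-close ε K ε>0 K>0
        η , η>0 , Lη≡ = *-close ε L ε>0 L>0
        M , close-y = cy δ δ>0
        N , close-x = cx η η>0
    in (A ⊔ B) ⊔ (M ⊔ N) , λ m n ≤m ≤n →
      let AB≤m = ℕ.m⊔n≤o⇒m≤o (A ⊔ B) (M ⊔ N) ≤m
          AB≤n = ℕ.m⊔n≤o⇒m≤o (A ⊔ B) (M ⊔ N) ≤n
          MN≤m = ℕ.m⊔n≤o⇒n≤o (A ⊔ B) (M ⊔ N) ≤m
          MN≤n = ℕ.m⊔n≤o⇒n≤o (A ⊔ B) (M ⊔ N) ≤n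
      in *-estimate (x m) (y m) (x n) (y n) {K} {L} {δ} {η} {ε} K>0 L>0 Kδ≡ Lη≡
           (bound-x m (ℕ.m⊔n≤o⇒m≤o A B AB≤m))
           (close-y m n (ℕ.m⊔n≤o⇒m≤o M N MN≤m) (ℕ.m⊔n≤o⇒m≤o M N MN≤n))
           (bound-y n (ℕ.m⊔n≤o⇒n≤o A B AB≤n))
           (close-x m n (ℕ.m⊔n≤o⇒n≤o M N MN≤m) (ℕ.m⊔n≤o⇒n≤o M N MN≤n))

fromℚ : ℚ → ℝ
fromℚ q = mkℝ (λ _ → q) (const-cauchy q)

fromℕ : ℕ → ℝ
fromℕ n = fromℚ ((+ n) ℚ./ 1)

0ᴿ 1ᴿ ½ᴿ : ℝ
0ᴿ = fromℚ 0ℚ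
1ᴿ = fromℚ 1ℚ
½ᴿ = fromℚ ½

infixl 6 _+ᴿ_
infixl 7 _*ᴿ_
infix  8 -ᴿ_

_+ᴿ_ _*ᴿ_ : ℝ → ℝ → ℝ
x +ᴿ y = mkℝ (λ n → seq x n ℚ.+ seq y n) (+-cauchy (seq x) (seq y) (cauchy x) (cauchy y))
x *ᴿ y = mkℝ (λ n → seq x n ℚ.* seq y n) (*-cauchy (seq x) (seq y) (cauchy x) (cauchy y))

-ᴿ_ : ℝ → ℝ
-ᴿ x = mkℝ (λ n → ℚ.- seq x n) (neg-cauchy (seq x) (cauchy x))

ℝ-rawRing : RawRing 0ℓ 0ℓ
ℝ-rawRing = record
  { Carrier = ℝ ; _≈_ = _≃_
  ; _+_ = _+ᴿ_ ; _*_ = _*ᴿ_ ; -_ = -ᴿ_ ; 0# = 0ᴿ ; 1# = 1ᴿ }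

open RawSemiringDefs (RawRing.rawSemiring ℝ-rawRing) public
  using () renaming (sum to ∑ᴿ; product to ∏ᴿ; _^_ to _^ᴿ_)

Point : ℕ → Set
Point n = Vector ℝ n

infix 4 _≃ᵛ_

_≃ᵛ_ : ∀ {n} → Point n → Point n → Set
x ≃ᵛ y = ∀ i → x i ≃ y i

combination : ∀ {n k} → Vector ℝ k → Vector (Point n) k → Point n
combination c p i = ∑ᴿ (λ j → c j *ᴿ p j i)

range : ∀ {n k} → Vector (Point n) k → Pred (Point n) 0ℓ
range p x = ∃[ j ] (x ≃ᵛ p j)

affineHull : ∀ {n} → Pred (Point n) 0ℓ → Pred (Point n) 0ℓ
affineHull {n} P x =
  ∃[ k ] Σ (Vector (Point n) k) λ p → Σ (Vector ℝ k) λ c →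
    (∀ j → p j ∈ P) × (∑ᴿ c ≃ 1ᴿ) × (x ≃ᵛ combination c p)

convexHull : ∀ {n} → Pred (Point n) 0ℓ → Pred (Point n) 0ℓ
convexHull {n} P x =
  ∃[ k ] Σ (Vector (Point n) k) λ p → Σ (Vector ℝ k) λ c →
    (∀ j → p j ∈ P) × (∀ j → 0ᴿ ≤ᴿ c j) × (∑ᴿ c ≃ 1ᴿ) × (x ≃ᵛ combination c p)

-- Interior relative to the affine hull; neighbourhoods are sup-norm balls.
relativeInterior : ∀ {n} → Pred (Point n) 0ℓ → Pred (Point n) 0ℓ
relativeInterior P x =
  x ∈ P × ∃[ ε ] (0ᴿ <ᴿ ε ×
    (∀ y → y ∈ affineHull P → (∀ i → y i <ᴿ x i +ᴿ ε × x i <ᴿ y i +ᴿ ε) → y ∈ P))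

AffinelyIndependent : ∀ {n k} → Vector (Point n) k → Set
AffinelyIndependent p =
  ∀ c → ∑ᴿ c ≃ 0ᴿ → combination c p ≃ᵛ (λ _ → 0ᴿ) → ∀ j → c j ≃ 0ᴿ

IsSimplexWithVertices : ∀ {n r} → Pred (Point n) 0ℓ → Vector (Point n) (suc r) → Set
IsSimplexWithVertices P v = AffinelyIndependent v × P ≐ convexHull (range v)

Exponent : ℕ → Set
Exponent n = Vec ℕ n

-- Finite formal sums of terms c·x^α, possibly with repeated or zero terms;
-- polynomials are these up to _≈ᴾ_, equality of all coefficients.
Poly : ℕ → Set
Poly n = List (ℝ × Exponent n)

coeff : ∀ {n} → Poly n → Exponent n → ℝ
coeff []            γ = 0ᴿ
coeff ((c , α) ∷ p) γ =
  if does (Vec.≡-dec ℕ._≟_ α γ) then c +ᴿ coeff p γ else coeff p γ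

infix 4 _≈ᴾ_

_≈ᴾ_ : ∀ {n} → Poly n → Poly n → Set
p ≈ᴾ q = ∀ γ → coeff p γ ≃ coeff q γ

monomial : ∀ {n} → ℝ → Exponent n → Poly n
monomial c α = (c , α) ∷ []

const : ∀ {n} → ℝ → Poly n
const c = monomial c (Vec.replicate _ 0)

var : ∀ {n} → Fin n → Poly n
var i = monomial 1ᴿ (Vec.replicate _ 0 Vec.[ i ]≔ 1)

infixl 6 _+ᴾ_ _-ᴾ_
infixl 7 _*ᴾ_
infix  8 -ᴾ_

-ᴾ_ : ∀ {n} → Poly n → Poly n
-ᴾ_ p = map (λ (c , α) → -ᴿ c , α) p

_+ᴾ_ _-ᴾ_ _*ᴾ_ : ∀ {n} → Poly n → Poly n → Poly n
p +ᴾ q = p ++ q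
p -ᴾ q = p +ᴾ (-ᴾ q)
p *ᴾ q = cartesianProductWith (λ (c , α) (d , β) → c *ᴿ d , Vec.zipWith ℕ._+_ α β) p q

Poly-rawRing : ℕ → RawRing 0ℓ 0ℓ
Poly-rawRing n = record
  { Carrier = Poly n ; _≈_ = _≈ᴾ_
  ; _+_ = _+ᴾ_ ; _*_ = _*ᴾ_ ; -_ = -ᴾ_ ; 0# = [] ; 1# = const 1ᴿ }

module _ {n : ℕ} where
  open RawSemiringDefs (RawRing.rawSemiring (Poly-rawRing n)) public
    using () renaming (sum to ∑ᴾ; product to ∏ᴾ)

evalMonomial : ∀ {n} → Exponent n → Point n → ℝ
evalMonomial α x = ∏ᴿ (λ i → x i ^ᴿ Vec.lookup α i)

eval : ∀ {n} → Poly n → Point n → ℝ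
eval []            x = 0ᴿ
eval ((c , α) ∷ p) x = c *ᴿ evalMonomial α x +ᴿ eval p x

Nonnegative : ∀ {n} → Poly n → Set
Nonnegative p = ∀ x → 0ᴿ ≤ᴿ eval p x

DegreeAtMost : ∀ {n} → ℕ → Poly n → Set
DegreeAtMost D p = ∀ γ → D ℕ.< Vec.sum γ → coeff p γ ≃ 0ᴿ

toPoint : ∀ {n} → Exponent n → Point n
toPoint α i = fromℕ (Vec.lookup α i)

NewtonPolytope : ∀ {n} → Poly n → Pred (Point n) 0ℓ
NewtonPolytope p = convexHull (λ x → ∃[ γ ] (coeff p γ ≄ 0ᴿ × x ≃ᵛ toPoint γ))

Even : ∀ {n} → Exponent n → Set
Even α = ∀ i → 2 ∣ Vec.lookup α i

record IsCircuit {n : ℕ} (f : Poly n) : Set where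
  field
    r          : ℕ
    r≤n        : r ℕ.≤ n
    α          : Vector (Exponent n) (suc r)
    β          : Exponent n
    fα         : Vector ℝ (suc r)
    fβ         : ℝ
    expansion  : f ≈ᴾ ∑ᴾ (λ j → monomial (fα j) (α j)) +ᴾ monomial fβ β
    fα-pos     : ∀ j → 0ᴿ <ᴿ fα j
    α-even     : ∀ j → Even (α j)
    simplex    : IsSimplexWithVertices (NewtonPolytope f) (λ j → toPoint (α j))
    β-interior : toPoint β ∈ relativeInterior (NewtonPolytope f)

IsMonomialSquare : ∀ {n} → Poly n → Set
IsMonomialSquare f = ∃[ c ] ∃[ α ] (0ᴿ <ᴿ c × Even α × f ≈ᴾ monomial c α)

IsNonnegativeCircuit : ∀ {n} → Poly n → Set
IsNonnegativeCircuit f = (IsCircuit f × Nonnegative f) ⊎ IsMonomialSquare f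

SONC : (n D : ℕ) → Pred (Poly n) 0ℓ
SONC n D f = DegreeAtMost D f ×
  (∃[ k ] Σ (Vector ℝ (suc k)) λ μ → Σ (Vector (Poly n) (suc k)) λ q →
    (∀ i → 0ᴿ ≤ᴿ μ i) × (∀ i → IsNonnegativeCircuit (q i)) ×
    f ≈ᴾ ∑ᴾ (λ i → const (μ i) *ᴾ q i))

data Multiplier {n : ℕ} : Pred (Poly n) 0ℓ where
  one   : Multiplier (const 1ᴿ)
  cube⁺ : ∀ i → Multiplier (var i *ᴾ var i -ᴾ const 1ᴿ)
  cube⁻ : ∀ i → Multiplier (-ᴾ (var i *ᴾ var i -ᴾ const 1ᴿ))
  box⁺  : ∀ i c → 0ᴿ ≤ᴿ c → Multiplier (const (1ᴿ +ᴿ c) +ᴾ var i)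
  box⁻  : ∀ i c → 0ᴿ ≤ᴿ c → Multiplier (const (1ᴿ +ᴿ c) -ᴾ var i)

S : (n d : ℕ) → Pred (Poly n) 0ℓ
S n d f =
  ∃[ k ] Σ (Vector (Poly n) k) λ s → Σ (Vector (Poly n) k) λ h →
    (∀ j → s j ∈ SONC n (2 ℕ.* d)) × (∀ j → h j ∈ Multiplier) ×
    f ≈ᴾ ∑ᴾ (λ j → s j *ᴾ h j)

f[_] : ∀ {n} → ℕ → Poly n
f[ a ] = const (fromℕ a +ᴿ -ᴿ 1ᴿ) *ᴾ ∏ᴾ (λ i → const ½ᴿ *ᴾ (var i +ᴾ const 1ᴿ)) +ᴾ const 1ᴿ

2ⁿ⁻²-1≢0 : ∀ {n} → 3 ℕ.≤ n → ℕ.NonZero (2 ℕ.^ (n ∸ 2) ∸ 1)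
2ⁿ⁻²-1≢0 {suc (suc (suc m))} (s≤s (s≤s (s≤s _))) =
  ℕ.>-nonZero (ℕ.m<n⇒0<n∸m (ℕ.*-monoʳ-≤ 2 (ℕ.m^n>0 2 m)))

-- (2ⁿ - 1) / (2ⁿ⁻² - 1).  For n = 2 the denominator vanishes, and for n = 1
-- it is negative and f₁ = 1 would lie in every S_d, so n ≥ 3 is required.
threshold : (n : ℕ) → 3 ℕ.≤ n → ℚ
threshold n 3≤n =
  ((+ (2 ℕ.^ n ∸ 1)) ℚ./ (2 ℕ.^ (n ∸ 2) ∸ 1)) {{2ⁿ⁻²-1≢0 3≤n}}

{-# OPTIONS --safe #-}

-- Let L(p) = 2²⁻ⁿ Σ_{x ∈ {±1}ⁿ} p(x) - p(1,…,1).  A nonnegative circuit polynomial has even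
-- vertices, so on the cube it is A + b x^β with A the sum of the positive coefficients; evaluating
-- at suitable cube points gives A + b ≥ 0, and A - b ≥ 0 when β is not even.  So on the cube s·h
-- is a nonnegative combination of products of at most one factor 1 ± x^β and one factor 1 ± x_i.
-- Such a product has mean over the cube at least a quarter of its value at (1,…,1), hence L ≥ 0
-- on S_d.  On the other hand f_a is 1 on the cube except for the value a at (1,…,1), so that
-- 2ⁿ⁻² L(f_a) = (2ⁿ - 1) - a (2ⁿ⁻² - 1) < 0.
module Submission where

open import Defs
open import Algebra.Bundles using (CommutativeMonoid; CommutativeRing)
import Algebra.Properties.CommutativeSemigroup as CommutativeSemigroupProperties
import Algebra.Properties.Group as GroupProperties
import Algebra.Solver.Ring as RingSolver
open import Algebra.Solver.Ring.AlmostCommutativeRing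
  using (AlmostCommutativeRing; fromCommutativeRing; _-Raw-AlmostCommutative⟶_)
open import Data.Bool.Base using (if_then_else_)
open import Data.Fin.Base using (Fin; zero; suc)
open import Data.Fin.Properties using (all?; ¬∀⟶∃¬; suc-injective; 0≢1+n)
open import Data.Integer using (+_)
import Data.Integer as ℤ
import Data.Integer.Properties as ℤ
open import Data.List.Base using ([]; _∷_; _++_; map; length; filter)
open import Data.List.Properties using (length-filter)
open import Data.Maybe.Base as Maybe using (Maybe)
open import Data.Nat using (ℕ; _≤_)
open import Data.Nat as ℕ using (zero; suc; _⊔_; s≤s)
open import Data.Nat.Divisibility
  using (_∣_; _∣?_; _∣0; ∣-refl; ∣1⇒≡1; ∣m∣n⇒∣m+n; ∣m+n∣m⇒∣n; m∣m*n)
import Data.Nat.Properties as ℕ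
open import Data.Product.Base using (_,_)
open import Data.Rational using (_/_; _<_)
open import Data.Rational as ℚ using (ℚ; 0ℚ; 1ℚ; ½; ∣_∣)
import Data.Rational.Properties as ℚ
open import Data.Rational.Unnormalised.Base as ℚᵘ using (mkℚᵘ; *≡*)
import Data.Rational.Unnormalised.Properties as ℚᵘ
open import Data.Sum.Base using (inj₁; inj₂)
open import Data.Vec.Base as Vec using (_∷_)
open import Data.Vec.Functional using (Vector)
import Data.Vec.Properties as Vec
open import Function.Base using (_∘_; id)
open import Function.Definitions using (Injective)
open import Level using (0ℓ)
open import Relation.Binary.Definitions using (DecidableEquality)
open import Relation.Binary.PropositionalEquality
  using (_≡_; _≢_; refl; sym; trans; cong; cong₂; subst)
import Relation.Binary.Reasoning.Setoid as SetoidReasoning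
open import Relation.Nullary using (¬_)
open import Relation.Nullary using (¬?; yes; no; contradiction; Dec; does)
open import Relation.Nullary.Decidable using (dec-true; dec-false; dec⇒maybe)
open import Relation.Unary using (_∈_)

-- The ordered ring of reals

open CommutativeSemigroupProperties
  (CommutativeMonoid.commutativeSemigroup ℚ.+-0-commutativeMonoid)
  using () renaming (interchange to +-interchange)

open GroupProperties ℚ.+-0-group using (⁻¹-involutive; ⁻¹-anti-homo-//)

-- The operations on `ℝ` act termwise on sequences, so this transfers each ring law from `ℚ` without
-- any estimate.
pointwise : ∀ {x y} → (∀ n → seq x n ≡ seq y n) → x ≃ y
pointwise {x} {y} eq = mk≃ λ ε ε>0 → 0 , λ n _ →
  subst (ℚ._< ε) (sym (cong ∣_∣ (trans (cong (ℚ._- seq y n) (eq n)) (ℚ.+-inverseʳ (seq y n))))) ε>0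

≃-refl : ∀ {x} → x ≃ x
≃-refl = pointwise λ _ → refl

≃-reflexive : ∀ {x y} → x ≡ y → x ≃ y
≃-reflexive refl = ≃-refl

≃-sym : ∀ {x y} → x ≃ y → y ≃ x
≃-sym {x} {y} (mk≃ close) = mk≃ λ ε ε>0 → let N , c = close ε ε>0 in
  N , λ n N≤n → subst (ℚ._< ε) (∣p-q∣≡∣q-p∣ (seq x n) (seq y n)) (c n N≤n)
  where
  ∣p-q∣≡∣q-p∣ : ∀ p q → ∣ p ℚ.- q ∣ ≡ ∣ q ℚ.- p ∣
  ∣p-q∣≡∣q-p∣ p q = trans (sym (ℚ.∣-p∣≡∣p∣ (p ℚ.- q))) (cong ∣_∣ (⁻¹-anti-homo-// p q))

≃-trans : ∀ {x y z} → x ≃ y → y ≃ z → x ≃ z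
≃-trans {x} {y} {z} (mk≃ c) (mk≃ d) = mk≃ λ ε ε>0 →
  let M , x≈y = c (½ ℚ.* ε) (half-pos ε ε>0)
      N , y≈z = d (½ ℚ.* ε) (half-pos ε ε>0)
  in M ⊔ N , λ n ≤n → let open ℚ.≤-Reasoning in begin-strict
    ∣ seq x n ℚ.- seq z n ∣
      ≡⟨ cong ∣_∣ (telescope (seq x n) (seq y n) (seq z n)) ⟨
    ∣ (seq x n ℚ.- seq y n) ℚ.+ (seq y n ℚ.- seq z n) ∣
      ≤⟨ ℚ.∣p+q∣≤∣p∣+∣q∣ (seq x n ℚ.- seq y n) (seq y n ℚ.- seq z n) ⟩
    ∣ seq x n ℚ.- seq y n ∣ ℚ.+ ∣ seq y n ℚ.- seq z n ∣
      <⟨ ℚ.+-mono-< (x≈y n (ℕ.m⊔n≤o⇒m≤o M N ≤n)) (y≈z n (ℕ.m⊔n≤o⇒n≤o M N ≤n)) ⟩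
    ½ ℚ.* ε ℚ.+ ½ ℚ.* ε
      ≡⟨ halves ε ⟩
    ε ∎

+ᴿ-cong : ∀ {x x′ y y′} → x ≃ x′ → y ≃ y′ → x +ᴿ y ≃ x′ +ᴿ y′
+ᴿ-cong {x} {x′} {y} {y′} (mk≃ c) (mk≃ d) = mk≃ λ ε ε>0 →
  let M , x≈x′ = c (½ ℚ.* ε) (half-pos ε ε>0)
      N , y≈y′ = d (½ ℚ.* ε) (half-pos ε ε>0)
  in M ⊔ N , λ n ≤n → let open ℚ.≤-Reasoning in begin-strict
    ∣ (seq x n ℚ.+ seq y n) ℚ.- (seq x′ n ℚ.+ seq y′ n) ∣
      ≡⟨ cong ∣_∣ (minus-+ (seq x n) (seq y n) (seq x′ n) (seq y′ n)) ⟩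
    ∣ (seq x n ℚ.- seq x′ n) ℚ.+ (seq y n ℚ.- seq y′ n) ∣
      ≤⟨ ℚ.∣p+q∣≤∣p∣+∣q∣ (seq x n ℚ.- seq x′ n) (seq y n ℚ.- seq y′ n) ⟩
    ∣ seq x n ℚ.- seq x′ n ∣ ℚ.+ ∣ seq y n ℚ.- seq y′ n ∣
      <⟨ ℚ.+-mono-< (x≈x′ n (ℕ.m⊔n≤o⇒m≤o M N ≤n)) (y≈y′ n (ℕ.m⊔n≤o⇒n≤o M N ≤n)) ⟩
    ½ ℚ.* ε ℚ.+ ½ ℚ.* ε
      ≡⟨ halves ε ⟩
    ε ∎

-- The difference splits as x (y - y′) + y′ (x - x′), so only `x` and `y′` need eventual bounds `K`
-- and `L`; the tolerances `δ` and `η` make each summand smaller than ε/2.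
*ᴿ-cong : ∀ {x x′ y y′} → x ≃ x′ → y ≃ y′ → x *ᴿ y ≃ x′ *ᴿ y′
*ᴿ-cong {x} {x′} {y} {y′} (mk≃ c) (mk≃ d) = mk≃ λ ε ε>0 →
  let K , K>0 , A , bound-x  = bounded (seq x) (cauchy x)
      L , L>0 , B , bound-y′ = bounded (seq y′) (cauchy y′)
      δ , δ>0 , Kδ≡ = *-close ε K ε>0 K>0
      η , η>0 , Lη≡ = *-close ε L ε>0 L>0
      M , x≈x′ = c η η>0
      N , y≈y′ = d δ δ>0
  in (A ⊔ B) ⊔ (M ⊔ N) , λ n ≤n →
    let AB≤n = ℕ.m⊔n≤o⇒m≤o (A ⊔ B) (M ⊔ N) ≤n
        MN≤n = ℕ.m⊔n≤o⇒n≤o (A ⊔ B) (M ⊔ N) ≤n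
    in *-estimate (seq x n) (seq y n) (seq x′ n) (seq y′ n) {K} {L} {δ} {η} {ε} K>0 L>0 Kδ≡ Lη≡
         (bound-x n (ℕ.m⊔n≤o⇒m≤o A B AB≤n)) (y≈y′ n (ℕ.m⊔n≤o⇒n≤o M N MN≤n))
         (bound-y′ n (ℕ.m⊔n≤o⇒n≤o A B AB≤n)) (x≈x′ n (ℕ.m⊔n≤o⇒m≤o M N MN≤n))

-ᴿ-cong : ∀ {x y} → x ≃ y → -ᴿ x ≃ -ᴿ y
-ᴿ-cong {x} {y} x≃y with mk≃ close ← ≃-sym x≃y = mk≃ λ ε ε>0 →
  let N , c = close ε ε>0 in N , λ n N≤n →
    subst (λ p → ∣ p ∣ ℚ.< ε)
      (trans (ℚ.+-comm (seq y n) (ℚ.- seq x n))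
             (cong (ℚ.- seq x n ℚ.+_) (sym (⁻¹-involutive (seq y n)))))
      (c n N≤n)

ℝ-commutativeRing : CommutativeRing 0ℓ 0ℓ
ℝ-commutativeRing = record
  { Carrier = ℝ ; _≈_ = _≃_ ; _+_ = _+ᴿ_ ; _*_ = _*ᴿ_ ; -_ = -ᴿ_ ; 0# = 0ᴿ ; 1# = 1ᴿ
  ; isCommutativeRing = record
    { isRing = record
      { +-isAbelianGroup = record
        { isGroup = record
          { isMonoid = record
            { isSemigroup = record
              { isMagma = record
                { isEquivalence = record { refl = ≃-refl ; sym = ≃-sym ; trans = ≃-trans }
                ; ∙-cong = +ᴿ-cong }
              ; assoc = λ x y z → pointwise λ n → ℚ.+-assoc (seq x n) (seq y n) (seq z n) }
            ; identity = (λ x → pointwise λ n → ℚ.+-identityˡ (seq x n))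
                       , (λ x → pointwise λ n → ℚ.+-identityʳ (seq x n)) }
          ; inverse = (λ x → pointwise λ n → ℚ.+-inverseˡ (seq x n))
                    , (λ x → pointwise λ n → ℚ.+-inverseʳ (seq x n))
          ; ⁻¹-cong = -ᴿ-cong }
        ; comm = λ x y → pointwise λ n → ℚ.+-comm (seq x n) (seq y n) }
      ; *-cong = *ᴿ-cong
      ; *-assoc = λ x y z → pointwise λ n → ℚ.*-assoc (seq x n) (seq y n) (seq z n)
      ; *-identity = (λ x → pointwise λ n → ℚ.*-identityˡ (seq x n))
                   , (λ x → pointwise λ n → ℚ.*-identityʳ (seq x n))
      ; distrib = (λ x y z → pointwise λ n → ℚ.*-distribˡ-+ (seq x n) (seq y n) (seq z n))
                , (λ x y z → pointwise λ n → ℚ.*-distribʳ-+ (seq x n) (seq y n) (seq z n)) }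
    ; *-comm = λ x y → pointwise λ n → ℚ.*-comm (seq x n) (seq y n) } }

module ≃-Reasoning = SetoidReasoning (CommutativeRing.setoid ℝ-commutativeRing)

ℝ-almostCommutativeRing : AlmostCommutativeRing 0ℓ 0ℓ
ℝ-almostCommutativeRing = fromCommutativeRing ℝ-commutativeRing

-- Rational rather than integer coefficients let the ring solver treat constants such as ½ and 1/4
-- in later identities.
fromℚ-morphism : ℚ.+-*-rawRing -Raw-AlmostCommutative⟶ ℝ-almostCommutativeRing
fromℚ-morphism = record
  { ⟦_⟧    = fromℚ
  ; +-homo = λ _ _ → pointwise λ _ → refl
  ; *-homo = λ _ _ → pointwise λ _ → refl
  ; -‿homo = λ _ → pointwise λ _ → refl
  ; 0-homo = ≃-refl
  ; 1-homo = ≃-refl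
  }

≃-weaklyDecidable : ∀ p q → Maybe (fromℚ p ≃ fromℚ q)
≃-weaklyDecidable p q = Maybe.map (λ p≡q → pointwise λ _ → p≡q) (dec⇒maybe (p ℚ.≟ q))

open RingSolver ℚ.+-*-rawRing ℝ-almostCommutativeRing fromℚ-morphism ≃-weaklyDecidable
  using (solve; _:=_; _:+_; _:*_; :-_; con)

infix 4 0≤_

0≤_ : ℝ → Set
0≤ x = 0ᴿ ≤ᴿ x

0≤-resp-≃ : ∀ {x y} → x ≃ y → 0≤ x → 0≤ y
0≤-resp-≃ {x} {y} (mk≃ c) (mk≤ b) = mk≤ λ ε ε>0 →
  let M , x≈y = c (½ ℚ.* ε) (half-pos ε ε>0)
      N , 0≤x = b (½ ℚ.* ε) (half-pos ε ε>0)
  in M ⊔ N , λ n ≤n → let open ℚ.≤-Reasoning in begin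
    0ℚ
      ≤⟨ 0≤x n (ℕ.m⊔n≤o⇒n≤o M N ≤n) ⟩
    seq x n ℚ.+ ½ ℚ.* ε
      ≡⟨ cong (ℚ._+ ½ ℚ.* ε) (cancel (seq x n) (seq y n)) ⟨
    seq y n ℚ.+ (seq x n ℚ.- seq y n) ℚ.+ ½ ℚ.* ε
      ≤⟨ ℚ.+-monoˡ-≤ (½ ℚ.* ε) (ℚ.+-monoʳ-≤ (seq y n)
           (ℚ.≤-trans (p≤∣p∣ (seq x n ℚ.- seq y n)) (ℚ.<⇒≤ (x≈y n (ℕ.m⊔n≤o⇒m≤o M N ≤n))))) ⟩
    seq y n ℚ.+ ½ ℚ.* ε ℚ.+ ½ ℚ.* ε
      ≡⟨ trans (ℚ.+-assoc (seq y n) (½ ℚ.* ε) (½ ℚ.* ε)) (cong (seq y n ℚ.+_) (halves ε)) ⟩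
    seq y n ℚ.+ ε ∎
  where
  p≤∣p∣ : ∀ p → p ℚ.≤ ∣ p ∣
  p≤∣p∣ p with ℚ.≤-total 0ℚ p
  ... | inj₁ 0≤p = ℚ.≤-reflexive (sym (ℚ.0≤p⇒∣p∣≡p 0≤p))
  ... | inj₂ p≤0 = ℚ.≤-trans p≤0 (ℚ.0≤∣p∣ p)

0≤-+ : ∀ {x y} → 0≤ x → 0≤ y → 0≤ (x +ᴿ y)
0≤-+ {x} {y} (mk≤ b) (mk≤ c) = mk≤ λ ε ε>0 →
  let M , 0≤x = b (½ ℚ.* ε) (half-pos ε ε>0)
      N , 0≤y = c (½ ℚ.* ε) (half-pos ε ε>0)
  in M ⊔ N , λ n ≤n → let open ℚ.≤-Reasoning in begin
    0ℚ ℚ.+ 0ℚ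
      ≤⟨ ℚ.+-mono-≤ (0≤x n (ℕ.m⊔n≤o⇒m≤o M N ≤n)) (0≤y n (ℕ.m⊔n≤o⇒n≤o M N ≤n)) ⟩
    (seq x n ℚ.+ ½ ℚ.* ε) ℚ.+ (seq y n ℚ.+ ½ ℚ.* ε)
      ≡⟨ +-interchange (seq x n) (½ ℚ.* ε) (seq y n) (½ ℚ.* ε) ⟩
    (seq x n ℚ.+ seq y n) ℚ.+ (½ ℚ.* ε ℚ.+ ½ ℚ.* ε)
      ≡⟨ cong (seq x n ℚ.+ seq y n ℚ.+_) (halves ε) ⟩
    seq x n ℚ.+ seq y n ℚ.+ ε ∎

p≥0∧q≥-δ⇒pq≥-Kδ : ∀ {p q K δ} → 0ℚ ℚ.≤ p → p ℚ.≤ K → 0ℚ ℚ.< δ → 0ℚ ℚ.≤ q ℚ.+ δ →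
  0ℚ ℚ.≤ p ℚ.* q ℚ.+ K ℚ.* δ
p≥0∧q≥-δ⇒pq≥-Kδ {p} {q} {K} {δ} 0≤p p≤K δ>0 0≤q+δ = begin
  0ℚ                        ≡⟨ ℚ.*-zeroʳ p ⟨
  p ℚ.* 0ℚ                  ≤⟨ ℚ.*-monoˡ-≤-nonNeg p {{ℚ.nonNegative 0≤p}} 0≤q+δ ⟩
  p ℚ.* (q ℚ.+ δ)           ≡⟨ ℚ.*-distribˡ-+ p q δ ⟩
  p ℚ.* q ℚ.+ p ℚ.* δ       ≤⟨ ℚ.+-monoʳ-≤ (p ℚ.* q)
                                 (ℚ.*-monoʳ-≤-nonNeg δ {{ℚ.nonNegative (ℚ.<⇒≤ δ>0)}} p≤K) ⟩
  p ℚ.* q ℚ.+ K ℚ.* δ       ∎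
  where open ℚ.≤-Reasoning

-- Terms of a nonnegative real may be slightly negative, hence the case split on signs. If one term
-- is nonnegative, it is at most its bound `K` or `L`, and the other is at least -`δ` or -`η`, so
-- the product is at least -ε/2; if both are nonpositive, the product is nonnegative outright.
0≤-* : ∀ {x y} → 0≤ x → 0≤ y → 0≤ (x *ᴿ y)
0≤-* {x} {y} (mk≤ b) (mk≤ c) = mk≤ λ ε ε>0 →
  let K , K>0 , A , bound-x = bounded (seq x) (cauchy x)
      L , L>0 , B , bound-y = bounded (seq y) (cauchy y)
      δ , δ>0 , Kδ≡ = *-close ε K ε>0 K>0
      η , η>0 , Lη≡ = *-close ε L ε>0 L>0
      M , 0≤x = b η η>0
      N , 0≤y = c δ δ>0
  in (A ⊔ B) ⊔ (M ⊔ N) , λ n ≤n →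
    let AB≤n = ℕ.m⊔n≤o⇒m≤o (A ⊔ B) (M ⊔ N) ≤n
        MN≤n = ℕ.m⊔n≤o⇒n≤o (A ⊔ B) (M ⊔ N) ≤n
    in estimate {seq x n} {seq y n} {K} {L} {δ} {η} {ε} ε>0 δ>0 η>0 Kδ≡ Lη≡
         (bound-x n (ℕ.m⊔n≤o⇒m≤o A B AB≤n)) (bound-y n (ℕ.m⊔n≤o⇒n≤o A B AB≤n))
         (0≤x n (ℕ.m⊔n≤o⇒m≤o M N MN≤n)) (0≤y n (ℕ.m⊔n≤o⇒n≤o M N MN≤n))
  where
  open ℚ.≤-Reasoning

  half-≤ : ∀ {ε} → 0ℚ ℚ.< ε → ½ ℚ.* ε ℚ.≤ ε
  half-≤ {ε} ε>0 = begin
    ½ ℚ.* ε               ≡⟨ ℚ.+-identityˡ (½ ℚ.* ε) ⟨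
    0ℚ ℚ.+ ½ ℚ.* ε        ≤⟨ ℚ.+-monoˡ-≤ (½ ℚ.* ε) (ℚ.<⇒≤ (half-pos ε ε>0)) ⟩
    ½ ℚ.* ε ℚ.+ ½ ℚ.* ε   ≡⟨ halves ε ⟩
    ε                     ∎

  estimate : ∀ {p q K L δ η ε} → 0ℚ ℚ.< ε → 0ℚ ℚ.< δ → 0ℚ ℚ.< η →
    K ℚ.* δ ≡ ½ ℚ.* ε → L ℚ.* η ≡ ½ ℚ.* ε → ∣ p ∣ ℚ.≤ K → ∣ q ∣ ℚ.≤ L →
    0ℚ ℚ.≤ p ℚ.+ η → 0ℚ ℚ.≤ q ℚ.+ δ → 0ℚ ℚ.≤ p ℚ.* q ℚ.+ ε
  estimate {p} {q} {K} {L} {δ} {η} {ε} ε>0 δ>0 η>0 Kδ≡ Lη≡ p≤K q≤L 0≤p+η 0≤q+δ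
    with ℚ.≤-total 0ℚ p | ℚ.≤-total 0ℚ q
  ... | inj₁ 0≤p | _ = begin
    0ℚ
      ≤⟨ p≥0∧q≥-δ⇒pq≥-Kδ {p} {q} {K} {δ} 0≤p (subst (ℚ._≤ K) (ℚ.0≤p⇒∣p∣≡p 0≤p) p≤K) δ>0 0≤q+δ ⟩
    p ℚ.* q ℚ.+ K ℚ.* δ     ≡⟨ cong (p ℚ.* q ℚ.+_) Kδ≡ ⟩
    p ℚ.* q ℚ.+ ½ ℚ.* ε     ≤⟨ ℚ.+-monoʳ-≤ (p ℚ.* q) (half-≤ ε>0) ⟩
    p ℚ.* q ℚ.+ ε           ∎
  ... | inj₂ p≤0 | inj₁ 0≤q = begin
    0ℚ
      ≤⟨ p≥0∧q≥-δ⇒pq≥-Kδ {q} {p} {L} {η} 0≤q (subst (ℚ._≤ L) (ℚ.0≤p⇒∣p∣≡p 0≤q) q≤L) η>0 0≤p+η ⟩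
    q ℚ.* p ℚ.+ L ℚ.* η     ≡⟨ cong₂ ℚ._+_ (ℚ.*-comm q p) Lη≡ ⟩
    p ℚ.* q ℚ.+ ½ ℚ.* ε     ≤⟨ ℚ.+-monoʳ-≤ (p ℚ.* q) (half-≤ ε>0) ⟩
    p ℚ.* q ℚ.+ ε           ∎
  ... | inj₂ p≤0 | inj₂ q≤0 =
    ℚ.+-mono-≤ {0ℚ} {p ℚ.* q} {0ℚ} {ε}
      (ℚ.nonNegative⁻¹ (p ℚ.* q)
        {{ℚ.nonPos*nonPos⇒nonPos p {{ℚ.nonPositive p≤0}} q {{ℚ.nonPositive q≤0}}}})
      (ℚ.<⇒≤ ε>0)

0≤-fromℚ : ∀ q → {{ℚ.NonNegative q}} → 0≤ fromℚ q
0≤-fromℚ q = mk≤ λ ε ε>0 → 0 , λ _ _ →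
  ℚ.+-mono-≤ {0ℚ} {q} {0ℚ} {ε} (ℚ.nonNegative⁻¹ q) (ℚ.<⇒≤ ε>0)

-- If q were negative, then q + ε would still be negative for ε = -q/2, against the defining bound
-- of `_≤ᴿ_`.
0≤-fromℚ⁻¹ : ∀ q → 0≤ fromℚ q → 0ℚ ℚ.≤ q
0≤-fromℚ⁻¹ q (mk≤ b) = ℚ.≮⇒≥ λ q<0 →
  let ε       = ½ ℚ.* (ℚ.- q)
      ε>0     = half-pos (ℚ.- q) (ℚ.neg-antimono-< q<0)
      N , 0≤q+ε = b ε ε>0
      open ℚ.≤-Reasoning
  in ℚ.<-irrefl refl (begin-strict
    0ℚ                ≤⟨ 0≤q+ε N ℕ.≤-refl ⟩
    q ℚ.+ ε           ≡⟨ ℚ.+-identityʳ (q ℚ.+ ε) ⟨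
    q ℚ.+ ε ℚ.+ 0ℚ    <⟨ ℚ.+-monoʳ-< (q ℚ.+ ε) ε>0 ⟩
    q ℚ.+ ε ℚ.+ ε     ≡⟨ ℚ.+-assoc q ε ε ⟩
    q ℚ.+ (ε ℚ.+ ε)   ≡⟨ cong (q ℚ.+_) (halves (ℚ.- q)) ⟩
    q ℚ.+ ℚ.- q       ≡⟨ ℚ.+-inverseʳ q ⟩
    0ℚ                ∎)

<⇒0≤ : ∀ {x} → 0ᴿ <ᴿ x → 0≤ x
<⇒0≤ {x} (mk< gap gap>0 (N , apart)) = mk≤ λ ε ε>0 → N , λ n N≤n →
  let open ℚ.≤-Reasoning in begin
    0ℚ              ≤⟨ ℚ.+-monoʳ-≤ 0ℚ (ℚ.<⇒≤ gap>0) ⟩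
    0ℚ ℚ.+ gap      ≤⟨ apart n N≤n ⟩
    seq x n         ≡⟨ ℚ.+-identityʳ (seq x n) ⟨
    seq x n ℚ.+ 0ℚ  ≤⟨ ℚ.+-monoʳ-≤ (seq x n) (ℚ.<⇒≤ ε>0) ⟩
    seq x n ℚ.+ ε   ∎

open ≃-Reasoning

-- Linear functionals on polynomials

infixl 6 _⊕_
_⊕_ : ∀ {n} → Exponent n → Exponent n → Exponent n
_⊕_ = Vec.zipWith ℕ._+_

-- The linear functional sending x^α to `φ α`. Evaluation at a point is one instance (`eval≡lin`),
-- the separating functional L another, so both obey the same lemmas.
lin : ∀ {n} → (Exponent n → ℝ) → Poly n → ℝ
lin φ []            = 0ᴿ
lin φ ((c , α) ∷ p) = c *ᴿ φ α +ᴿ lin φ p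

lin-++ : ∀ {n} (φ : Exponent n → ℝ) p q → lin φ (p +ᴾ q) ≃ lin φ p +ᴿ lin φ q
lin-++ φ []            q = solve 1 (λ x → x := con 0ℚ :+ x) ≃-refl (lin φ q)
lin-++ φ ((c , α) ∷ p) q = begin
  c *ᴿ φ α +ᴿ lin φ (p ++ q)         ≈⟨ +ᴿ-cong ≃-refl (lin-++ φ p q) ⟩
  c *ᴿ φ α +ᴿ (lin φ p +ᴿ lin φ q)
    ≈⟨ solve 3 (λ x y z → x :+ (y :+ z) := x :+ y :+ z) ≃-refl _ _ _ ⟩
  c *ᴿ φ α +ᴿ lin φ p +ᴿ lin φ q     ∎

lin-neg : ∀ {n} (φ : Exponent n → ℝ) p → lin φ (-ᴾ p) ≃ -ᴿ lin φ p
lin-neg φ []            = solve 0 (con 0ℚ := :- con 0ℚ) ≃-refl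
lin-neg φ ((c , α) ∷ p) = begin
  -ᴿ c *ᴿ φ α +ᴿ lin φ (-ᴾ p)   ≈⟨ +ᴿ-cong ≃-refl (lin-neg φ p) ⟩
  -ᴿ c *ᴿ φ α +ᴿ -ᴿ lin φ p
    ≈⟨ solve 3 (λ x y z → :- x :* y :+ :- z := :- (x :* y :+ z)) ≃-refl _ _ _ ⟩
  -ᴿ (c *ᴿ φ α +ᴿ lin φ p)      ∎

lin-congˡ : ∀ {n} {φ ψ : Exponent n → ℝ} → (∀ α → φ α ≃ ψ α) → ∀ p → lin φ p ≃ lin ψ p
lin-congˡ φ≃ψ []            = ≃-refl
lin-congˡ φ≃ψ ((c , α) ∷ p) = +ᴿ-cong (*ᴿ-cong ≃-refl (φ≃ψ α)) (lin-congˡ φ≃ψ p)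

lin-∑ : ∀ {n k} (φ : Exponent n → ℝ) (p : Vector (Poly n) k) → lin φ (∑ᴾ p) ≃ ∑ᴿ (lin φ ∘ p)
lin-∑ {k = zero}  φ p = ≃-refl
lin-∑ {k = suc k} φ p =
  ≃-trans (lin-++ φ (p zero) (∑ᴾ (p ∘ suc))) (+ᴿ-cong ≃-refl (lin-∑ φ (p ∘ suc)))

lin-monomial : ∀ {n} (φ : Exponent n → ℝ) c α → lin φ (monomial c α) ≃ c *ᴿ φ α
lin-monomial φ c α = solve 1 (λ x → x :+ con 0ℚ := x) ≃-refl (c *ᴿ φ α)

-- For fixed `q`, the map p ↦ `lin φ (p *ᴾ q)` is again of the form `lin ψ`, with `ψ α` the value at
-- x^α q. A multiplier can thus be absorbed into the functional, which leaves a functional on the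
-- SONC factor alone.
lin-* : ∀ {n} (φ : Exponent n → ℝ) p q →
  lin φ (p *ᴾ q) ≃ lin (λ α → lin (λ β → φ (α ⊕ β)) q) p
lin-* φ []            q = ≃-refl
lin-* φ ((c , α) ∷ p) q = ≃-trans
  (lin-++ φ (map (λ (d , β) → c *ᴿ d , α ⊕ β) q) (p *ᴾ q))
  (+ᴿ-cong (scaled-shift q) (lin-* φ p q))
  where
  scaled-shift : ∀ q → lin φ (map (λ (d , β) → c *ᴿ d , α ⊕ β) q) ≃ c *ᴿ lin (λ β → φ (α ⊕ β)) q
  scaled-shift []            = solve 1 (λ x → con 0ℚ := x :* con 0ℚ) ≃-refl c
  scaled-shift ((d , β) ∷ q) = begin
    c *ᴿ d *ᴿ φ (α ⊕ β) +ᴿ lin φ (map _ q)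
      ≈⟨ +ᴿ-cong ≃-refl (scaled-shift q) ⟩
    c *ᴿ d *ᴿ φ (α ⊕ β) +ᴿ c *ᴿ lin (λ β → φ (α ⊕ β)) q
      ≈⟨ solve 4 (λ c d x y → c :* d :* x :+ c :* y := c :* (d :* x :+ y)) ≃-refl _ _ _ _ ⟩
    c *ᴿ (d *ᴿ φ (α ⊕ β) +ᴿ lin (λ β → φ (α ⊕ β)) q) ∎

⊕-identityˡ : ∀ {n} (α : Exponent n) → Vec.replicate n 0 ⊕ α ≡ α
⊕-identityˡ = Vec.zipWith-identityˡ ℕ.+-identityˡ

lin-const-* : ∀ {n} (φ : Exponent n → ℝ) c p → lin φ (const c *ᴾ p) ≃ c *ᴿ lin φ p
lin-const-* {n} φ c p = begin
  lin φ (const c *ᴾ p)                                    ≈⟨ lin-* φ (const c) p ⟩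
  lin (λ α → lin (λ β → φ (α ⊕ β)) p) (const c)
    ≈⟨ lin-monomial (λ α → lin (λ β → φ (α ⊕ β)) p) c (Vec.replicate n 0) ⟩
  c *ᴿ lin (λ β → φ (Vec.replicate n 0 ⊕ β)) p
    ≈⟨ *ᴿ-cong ≃-refl (lin-congˡ (λ β → ≃-reflexive (cong φ (⊕-identityˡ β))) p) ⟩
  c *ᴿ lin φ p                                            ∎

-- Invariance of functionals under equality of coefficients

_≟ᴱ_ : ∀ {n} → DecidableEquality (Exponent n)
_≟ᴱ_ = Vec.≡-dec ℕ._≟_

without : ∀ {n} → Exponent n → Poly n → Poly n
without α = filter (λ (_ , β) → ¬? (β ≟ᴱ α))

lin-split : ∀ {n} (φ : Exponent n → ℝ) α p → lin φ p ≃ coeff p α *ᴿ φ α +ᴿ lin φ (without α p)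
lin-split φ α []            = solve 1 (λ x → con 0ℚ := con 0ℚ :* x :+ con 0ℚ) ≃-refl (φ α)
lin-split φ α ((c , β) ∷ p) with β ≟ᴱ α
... | yes refl = ≃-trans (+ᴿ-cong ≃-refl (lin-split φ α p))
  (solve 4 (λ c x y z → c :* x :+ (y :* x :+ z) := (c :+ y) :* x :+ z) ≃-refl _ _ _ _)
... | no  _    = ≃-trans (+ᴿ-cong ≃-refl (lin-split φ α p))
  (solve 3 (λ x y z → x :+ (y :+ z) := y :+ (x :+ z)) ≃-refl _ _ _)

coeff-without-≡ : ∀ {n} (α : Exponent n) p → coeff (without α p) α ≡ 0ᴿ
coeff-without-≡ α []            = refl
coeff-without-≡ α ((c , β) ∷ p) with β ≟ᴱ α in eq
... | yes _ = coeff-without-≡ α p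
... | no  _ rewrite eq = coeff-without-≡ α p

coeff-without-≢ : ∀ {n} {α γ : Exponent n} → α ≢ γ → ∀ p → coeff (without α p) γ ≡ coeff p γ
coeff-without-≢         α≢γ []            = refl
coeff-without-≢ {α = α} {γ} α≢γ ((c , β) ∷ p) with β ≟ᴱ α
... | yes refl rewrite dec-false (α ≟ᴱ γ) α≢γ = coeff-without-≢ α≢γ p
... | no  _ with β ≟ᴱ γ
...   | yes _ = cong (c +ᴿ_) (coeff-without-≢ α≢γ p)
...   | no  _ = coeff-without-≢ α≢γ p

-- Repeated exponents may cancel, so the tail of a sum with zero coefficients need not have zero
-- coefficients. Instead all terms sharing the exponent of the head are removed at once: by
-- `lin-split` they contribute a multiple of a zero coefficient, and the other coefficients are
-- unchanged. The head itself is among the removed terms, so recursion on a bound `k` for the length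
-- terminates.
lin-zero : ∀ {n} (φ : Exponent n → ℝ) p → (∀ γ → coeff p γ ≃ 0ᴿ) → lin φ p ≃ 0ᴿ
lin-zero {n} φ p p≃0 = go (length p) p ℕ.≤-refl p≃0
  where
  go : ∀ k (p : Poly n) → length p ≤ k → (∀ γ → coeff p γ ≃ 0ᴿ) → lin φ p ≃ 0ᴿ
  go k       []              _          _   = ≃-refl
  go (suc k) p@((c , α) ∷ p′) (s≤s ≤k) p≃0 = begin
    lin φ p                                    ≈⟨ lin-split φ α p ⟩
    coeff p α *ᴿ φ α +ᴿ lin φ (without α p)
      ≈⟨ +ᴿ-cong (*ᴿ-cong (p≃0 α) ≃-refl) (go k (without α p) shorter without≃0) ⟩
    0ᴿ *ᴿ φ α +ᴿ 0ᴿ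
      ≈⟨ solve 1 (λ x → con 0ℚ :* x :+ con 0ℚ := con 0ℚ) ≃-refl (φ α) ⟩
    0ᴿ                                         ∎
    where
    shorter : length (without α p) ≤ k
    shorter with α ≟ᴱ α
    ... | yes _  = ℕ.≤-trans (length-filter _ p′) ≤k
    ... | no α≢α = contradiction refl α≢α

    without≃0 : ∀ γ → coeff (without α p) γ ≃ 0ᴿ
    without≃0 γ with α ≟ᴱ γ
    ... | yes refl = ≃-reflexive (coeff-without-≡ α p)
    ... | no α≢γ   = ≃-trans (≃-reflexive (coeff-without-≢ α≢γ p)) (p≃0 γ)

coeff--ᴾ : ∀ {n} (p q : Poly n) γ → coeff (p -ᴾ q) γ ≃ coeff p γ +ᴿ -ᴿ coeff q γ
coeff--ᴾ []            []            γ = solve 0 (con 0ℚ := con 0ℚ :+ :- con 0ℚ) ≃-refl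
coeff--ᴾ []            ((c , α) ∷ q) γ with α ≟ᴱ γ
... | yes _ = ≃-trans (+ᴿ-cong ≃-refl (coeff--ᴾ [] q γ))
  (solve 2 (λ c x → :- c :+ (con 0ℚ :+ :- x) := con 0ℚ :+ :- (c :+ x)) ≃-refl _ _)
... | no  _ = coeff--ᴾ [] q γ
coeff--ᴾ ((c , α) ∷ p) q             γ with α ≟ᴱ γ
... | yes _ = ≃-trans (+ᴿ-cong ≃-refl (coeff--ᴾ p q γ))
  (solve 3 (λ c x y → c :+ (x :+ :- y) := c :+ x :+ :- y) ≃-refl _ _ _)
... | no  _ = coeff--ᴾ p q γ

-- Equality of coefficients gives no matching between the two lists of terms, so the argument passes
-- through the difference, to which `lin-zero` applies.
lin-congʳ : ∀ {n} (φ : Exponent n → ℝ) p q → p ≈ᴾ q → lin φ p ≃ lin φ q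
lin-congʳ φ p q p≈q = begin
  lin φ p
    ≈⟨ solve 2 (λ x y → x := x :+ :- y :+ y) ≃-refl (lin φ p) (lin φ q) ⟩
  lin φ p +ᴿ -ᴿ lin φ q +ᴿ lin φ q       ≈⟨ +ᴿ-cong (+ᴿ-cong ≃-refl (≃-sym (lin-neg φ q))) ≃-refl ⟩
  lin φ p +ᴿ lin φ (-ᴾ q) +ᴿ lin φ q     ≈⟨ +ᴿ-cong (≃-sym (lin-++ φ p (-ᴾ q))) ≃-refl ⟩
  lin φ (p -ᴾ q) +ᴿ lin φ q              ≈⟨ +ᴿ-cong (lin-zero φ (p -ᴾ q) difference≃0) ≃-refl ⟩
  0ᴿ +ᴿ lin φ q                          ≈⟨ solve 1 (λ x → con 0ℚ :+ x := x) ≃-refl (lin φ q) ⟩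
  lin φ q                                ∎
  where
  difference≃0 : ∀ γ → coeff (p -ᴾ q) γ ≃ 0ᴿ
  difference≃0 γ = begin
    coeff (p -ᴾ q) γ                ≈⟨ coeff--ᴾ p q γ ⟩
    coeff p γ +ᴿ -ᴿ coeff q γ       ≈⟨ +ᴿ-cong (p≈q γ) ≃-refl ⟩
    coeff q γ +ᴿ -ᴿ coeff q γ       ≈⟨ solve 1 (λ x → x :+ :- x := con 0ℚ) ≃-refl (coeff q γ) ⟩
    0ᴿ                              ∎

-- Nonnegative circuit polynomials at points of the cube

∑ᴿ-cong : ∀ {k} {f g : Vector ℝ k} → (∀ i → f i ≃ g i) → ∑ᴿ f ≃ ∑ᴿ g
∑ᴿ-cong {zero}  f≃g = ≃-refl
∑ᴿ-cong {suc k} f≃g = +ᴿ-cong (f≃g zero) (∑ᴿ-cong (f≃g ∘ suc))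

∑ᴿ-*-distribʳ : ∀ {k} (f : Vector ℝ k) c → ∑ᴿ (λ i → f i *ᴿ c) ≃ ∑ᴿ f *ᴿ c
∑ᴿ-*-distribʳ {zero}  f c = solve 1 (λ c → con 0ℚ := con 0ℚ :* c) ≃-refl c
∑ᴿ-*-distribʳ {suc k} f c = begin
  f zero *ᴿ c +ᴿ ∑ᴿ (λ i → f (suc i) *ᴿ c)   ≈⟨ +ᴿ-cong ≃-refl (∑ᴿ-*-distribʳ (f ∘ suc) c) ⟩
  f zero *ᴿ c +ᴿ ∑ᴿ (f ∘ suc) *ᴿ c
    ≈⟨ solve 3 (λ x y c → x :* c :+ y :* c := (x :+ y) :* c) ≃-refl _ _ _ ⟩
  (f zero +ᴿ ∑ᴿ (f ∘ suc)) *ᴿ c              ∎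

0≤-∑ᴿ : ∀ {k} {f : Vector ℝ k} → (∀ i → 0≤ f i) → 0≤ ∑ᴿ f
0≤-∑ᴿ {zero}  0≤f = 0≤-fromℚ 0ℚ
0≤-∑ᴿ {suc k} 0≤f = 0≤-+ (0≤f zero) (0≤-∑ᴿ (0≤f ∘ suc))

∏ᴿ-≃1 : ∀ {k} {f : Vector ℝ k} → (∀ i → f i ≃ 1ᴿ) → ∏ᴿ f ≃ 1ᴿ
∏ᴿ-≃1 {zero}  f≃1 = ≃-refl
∏ᴿ-≃1 {suc k} f≃1 = ≃-trans (*ᴿ-cong (f≃1 zero) (∏ᴿ-≃1 (f≃1 ∘ suc)))
  (solve 0 (con 1ℚ :* con 1ℚ := con 1ℚ) ≃-refl)

eval≡lin : ∀ {n} (p : Poly n) x → eval p x ≡ lin (λ α → evalMonomial α x) p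
eval≡lin []            x = refl
eval≡lin ((c , α) ∷ p) x = cong (c *ᴿ evalMonomial α x +ᴿ_) (eval≡lin p x)

1^k≃1 : ∀ k → 1ᴿ ^ᴿ k ≃ 1ᴿ
1^k≃1 zero    = ≃-refl
1^k≃1 (suc k) = ≃-trans (solve 1 (λ x → con 1ℚ :* x := x) ≃-refl (1ᴿ ^ᴿ k)) (1^k≃1 k)

sq≃1⇒^even≃1 : ∀ {s} k → s *ᴿ s ≃ 1ᴿ → 2 ∣ k → s ^ᴿ k ≃ 1ᴿ
sq≃1⇒^even≃1         zero          s²≃1 _   = ≃-refl
sq≃1⇒^even≃1         (suc zero)    s²≃1 2∣1 = contradiction (∣1⇒≡1 2∣1) λ ()
sq≃1⇒^even≃1 {s = s} (suc (suc k)) s²≃1 2∣k = begin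
  s *ᴿ (s *ᴿ s ^ᴿ k)   ≈⟨ solve 2 (λ s x → s :* (s :* x) := s :* s :* x) ≃-refl s (s ^ᴿ k) ⟩
  s *ᴿ s *ᴿ s ^ᴿ k     ≈⟨ *ᴿ-cong s²≃1 (sq≃1⇒^even≃1 k s²≃1 (∣m+n∣m⇒∣n 2∣k ∣-refl)) ⟩
  1ᴿ *ᴿ 1ᴿ             ≈⟨ solve 0 (con 1ℚ :* con 1ℚ := con 1ℚ) ≃-refl ⟩
  1ᴿ                   ∎

sq≃1⇒^odd≃ : ∀ {s} k → s *ᴿ s ≃ 1ᴿ → ¬ 2 ∣ k → s ^ᴿ k ≃ s
sq≃1⇒^odd≃ zero    s²≃1 2∤0 = contradiction (2 ∣0) 2∤0
sq≃1⇒^odd≃ {s} (suc zero) s²≃1 _ = solve 1 (λ s → s :* con 1ℚ := s) ≃-refl s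
sq≃1⇒^odd≃ {s = s} (suc (suc k)) s²≃1 2∤k = begin
  s *ᴿ (s *ᴿ s ^ᴿ k)   ≈⟨ solve 2 (λ s x → s :* (s :* x) := s :* s :* x) ≃-refl s (s ^ᴿ k) ⟩
  s *ᴿ s *ᴿ s ^ᴿ k     ≈⟨ *ᴿ-cong s²≃1 (sq≃1⇒^odd≃ k s²≃1 (2∤k ∘ ∣m∣n⇒∣m+n ∣-refl)) ⟩
  1ᴿ *ᴿ s              ≈⟨ solve 1 (λ s → con 1ℚ :* s := s) ≃-refl s ⟩
  s                    ∎

evalMonomial-even : ∀ {n} (α : Exponent n) {x} → (∀ i → x i *ᴿ x i ≃ 1ᴿ) → Even α →
  evalMonomial α x ≃ 1ᴿ
evalMonomial-even α x²≃1 α-even =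
  ∏ᴿ-≃1 λ i → sq≃1⇒^even≃1 (Vec.lookup α i) (x²≃1 i) (α-even i)

ones : ∀ {n} → Point n
ones _ = 1ᴿ

-- Recursion on both indices follows the recursion of `∏ᴿ`, so monomials at this point can be
-- computed by induction on `j`.
flip : ∀ {n} → Fin n → Point n
flip zero    zero    = -ᴿ 1ᴿ
flip zero    (suc i) = 1ᴿ
flip (suc j) zero    = 1ᴿ
flip (suc j) (suc i) = flip j i

1²≃1 : 1ᴿ *ᴿ 1ᴿ ≃ 1ᴿ
1²≃1 = solve 0 (con 1ℚ :* con 1ℚ := con 1ℚ) ≃-refl

-1²≃1 : -ᴿ 1ᴿ *ᴿ -ᴿ 1ᴿ ≃ 1ᴿ
-1²≃1 = solve 0 (:- con 1ℚ :* :- con 1ℚ := con 1ℚ) ≃-refl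

flip²≃1 : ∀ {n} (j i : Fin n) → flip j i *ᴿ flip j i ≃ 1ᴿ
flip²≃1 zero    zero    = -1²≃1
flip²≃1 zero    (suc i) = 1²≃1
flip²≃1 (suc j) zero    = 1²≃1
flip²≃1 (suc j) (suc i) = flip²≃1 j i

evalMonomial-ones : ∀ {n} (β : Exponent n) → evalMonomial β ones ≃ 1ᴿ
evalMonomial-ones β = ∏ᴿ-≃1 λ i → 1^k≃1 (Vec.lookup β i)

evalMonomial-flip : ∀ {n} (β : Exponent n) j →
  ¬ 2 ∣ Vec.lookup β j → evalMonomial β (flip j) ≃ -ᴿ 1ᴿ
evalMonomial-flip (b ∷ β) zero    2∤b = ≃-trans
  (*ᴿ-cong (sq≃1⇒^odd≃ b -1²≃1 2∤b) (evalMonomial-ones β))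
  (solve 0 (:- con 1ℚ :* con 1ℚ := :- con 1ℚ) ≃-refl)
evalMonomial-flip (b ∷ β) (suc j) 2∤βⱼ = ≃-trans
  (*ᴿ-cong (1^k≃1 b) (evalMonomial-flip β j 2∤βⱼ))
  (solve 0 (con 1ℚ :* :- con 1ℚ := :- con 1ℚ) ≃-refl)

module _ {n} {f : Poly n} (circuit : IsCircuit f) where
  open IsCircuit circuit

  -- A functional that is constant on the vertices sees them only through the sum of their
  -- coefficients. The lemma serves twice: for evaluation at cube points, where `H` is 1, and for
  -- admissible functionals, where `H` is their level.
  lin-circuit : ∀ (ψ : Exponent n → ℝ) {H} → (∀ j → ψ (α j) ≃ H) → lin ψ f ≃ ∑ᴿ fα *ᴿ H +ᴿ fβ *ᴿ ψ β
  lin-circuit ψ {H} ψα≃H = begin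
    lin ψ f
      ≈⟨ lin-congʳ ψ f (∑ᴾ (λ j → monomial (fα j) (α j)) +ᴾ monomial fβ β) expansion ⟩
    lin ψ (∑ᴾ (λ j → monomial (fα j) (α j)) +ᴾ monomial fβ β)
      ≈⟨ lin-++ ψ (∑ᴾ (λ j → monomial (fα j) (α j))) (monomial fβ β) ⟩
    lin ψ (∑ᴾ (λ j → monomial (fα j) (α j))) +ᴿ lin ψ (monomial fβ β)
      ≈⟨ +ᴿ-cong (lin-∑ ψ (λ j → monomial (fα j) (α j))) (lin-monomial ψ fβ β) ⟩
    ∑ᴿ (λ j → lin ψ (monomial (fα j) (α j))) +ᴿ fβ *ᴿ ψ β
      ≈⟨ +ᴿ-cong (∑ᴿ-cong λ j → ≃-trans (lin-monomial ψ (fα j) (α j)) (*ᴿ-cong ≃-refl (ψα≃H j))) ≃-refl ⟩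
    ∑ᴿ (λ j → fα j *ᴿ H) +ᴿ fβ *ᴿ ψ β
      ≈⟨ +ᴿ-cong (∑ᴿ-*-distribʳ fα H) ≃-refl ⟩
    ∑ᴿ fα *ᴿ H +ᴿ fβ *ᴿ ψ β ∎

  module _ (f≥0 : Nonnegative f) where

    circuit-value≥0 : ∀ {x s} → (∀ i → x i *ᴿ x i ≃ 1ᴿ) →
      evalMonomial β x ≃ s → 0≤ (∑ᴿ fα +ᴿ fβ *ᴿ s)
    circuit-value≥0 {x} {s} x²≃1 βx≃s = 0≤-resp-≃ (begin
      eval f x                                 ≈⟨ ≃-reflexive (eval≡lin f x) ⟩
      lin (λ γ → evalMonomial γ x) f
        ≈⟨ lin-circuit (λ γ → evalMonomial γ x) (λ j → evalMonomial-even (α j) x²≃1 (α-even j)) ⟩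
      ∑ᴿ fα *ᴿ 1ᴿ +ᴿ fβ *ᴿ evalMonomial β x
        ≈⟨ +ᴿ-cong (solve 1 (λ A → A :* con 1ℚ := A) ≃-refl (∑ᴿ fα)) (*ᴿ-cong ≃-refl βx≃s) ⟩
      ∑ᴿ fα +ᴿ fβ *ᴿ s                         ∎) (f≥0 x)

    ∑fα+fβ≥0 : 0≤ (∑ᴿ fα +ᴿ fβ *ᴿ 1ᴿ)
    ∑fα+fβ≥0 = circuit-value≥0 {ones} (λ _ → 1²≃1) (evalMonomial-ones β)

    ∑fα-fβ≥0 : ¬ Even β → 0≤ (∑ᴿ fα +ᴿ fβ *ᴿ -ᴿ 1ᴿ)
    -- Some coordinate of `β` is odd; negating just that coordinate of (1,...,1) gives a cube point
    -- with x^β = -1.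
    ∑fα-fβ≥0 β-odd with j , 2∤βⱼ ← ¬∀⟶∃¬ n (λ i → 2 ∣ Vec.lookup β i) (λ i → 2 ∣? Vec.lookup β i) β-odd
      = circuit-value≥0 (flip²≃1 j) (evalMonomial-flip β j 2∤βⱼ)

-- Functionals nonnegative on SONC polynomials

even? : ∀ {n} (α : Exponent n) → Dec (Even α)
even? α = all? λ i → 2 ∣? Vec.lookup α i

-- The last two fields together say that |ψ β| ≤ `level` off the even exponents. On the cube every
-- even monomial is 1, hence the common value there. Splitting the absolute value into two
-- inequalities supplies the factors used in `lin-circuit≥0`.
record Admissible {n} (ψ : Exponent n → ℝ) : Set where
  field
    level   : ℝ
    level≥0 : 0≤ level
    on-even : ∀ {α} → Even α → ψ α ≃ level
    ≥-level : ∀ {β} → ¬ Even β → 0≤ (level +ᴿ ψ β)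
    ≤-level : ∀ {β} → ¬ Even β → 0≤ (level +ᴿ -ᴿ ψ β)

module _ {n} {ψ : Exponent n → ℝ} (admissible : Admissible ψ) where
  open Admissible admissible

  lin-circuit≥0 : ∀ {q} → IsNonnegativeCircuit q → 0≤ lin ψ q
  lin-circuit≥0 {q} (inj₂ (c , α , c>0 , α-even , q≈cx^α)) =
    0≤-resp-≃ (≃-sym (begin
      lin ψ q                ≈⟨ lin-congʳ ψ q (monomial c α) q≈cx^α ⟩
      lin ψ (monomial c α)   ≈⟨ lin-monomial ψ c α ⟩
      c *ᴿ ψ α               ≈⟨ *ᴿ-cong ≃-refl (on-even α-even) ⟩
      c *ᴿ level             ∎))
    (0≤-* (<⇒0≤ c>0) level≥0)
  lin-circuit≥0 {q} (inj₁ (circuit , q≥0)) with even? (IsCircuit.β circuit)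
  ... | yes β-even =
    0≤-resp-≃ (≃-sym (begin
      lin ψ q                           ≈⟨ lin-circuit circuit ψ (λ j → on-even (α-even j)) ⟩
      ∑ᴿ fα *ᴿ level +ᴿ fβ *ᴿ ψ β       ≈⟨ +ᴿ-cong ≃-refl (*ᴿ-cong ≃-refl (on-even β-even)) ⟩
      ∑ᴿ fα *ᴿ level +ᴿ fβ *ᴿ level
        ≈⟨ solve 3 (λ A b H → A :* H :+ b :* H := (A :+ b :* con 1ℚ) :* H) ≃-refl _ _ _ ⟩
      (∑ᴿ fα +ᴿ fβ *ᴿ 1ᴿ) *ᴿ level      ∎))
    (0≤-* (∑fα+fβ≥0 circuit q≥0) level≥0)
    where open IsCircuit circuit
  ... | no β-odd =
    0≤-resp-≃ (≃-sym (begin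
      lin ψ q
        ≈⟨ lin-circuit circuit ψ (λ j → on-even (α-even j)) ⟩
      ∑ᴿ fα *ᴿ level +ᴿ fβ *ᴿ ψ β
        -- With H the level and φ = ψ β, A H + b φ is half of (A + b)(H + φ) + (A - b)(H - φ). The
        -- four factors are nonnegative, the first of each pair by evaluation at cube points, the
        -- second by admissibility.
        ≈⟨ solve 4 (λ A b H φ → A :* H :+ b :* φ :=
             con ½ :* ((A :+ b :* con 1ℚ) :* (H :+ φ) :+ (A :+ b :* :- con 1ℚ) :* (H :+ :- φ)))
             ≃-refl (∑ᴿ fα) fβ level (ψ β) ⟩
      ½ᴿ *ᴿ ((∑ᴿ fα +ᴿ fβ *ᴿ 1ᴿ) *ᴿ (level +ᴿ ψ β)
             +ᴿ (∑ᴿ fα +ᴿ fβ *ᴿ -ᴿ 1ᴿ) *ᴿ (level +ᴿ -ᴿ ψ β)) ∎))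
    (0≤-* (0≤-fromℚ ½) (0≤-+
      (0≤-* (∑fα+fβ≥0 circuit q≥0) (≥-level β-odd))
      (0≤-* (∑fα-fβ≥0 circuit q≥0 β-odd) (≤-level β-odd))))
    where open IsCircuit circuit

  lin-SONC≥0 : ∀ {D s} → s ∈ SONC n D → 0≤ lin ψ s
  lin-SONC≥0 {s = s} (_ , k , μ , q , μ≥0 , q-circuit , s≈) =
    0≤-resp-≃ (≃-sym (begin
      lin ψ s                                 ≈⟨ lin-congʳ ψ s (∑ᴾ (λ i → const (μ i) *ᴾ q i)) s≈ ⟩
      lin ψ (∑ᴾ (λ i → const (μ i) *ᴾ q i))   ≈⟨ lin-∑ ψ (λ i → const (μ i) *ᴾ q i) ⟩
      ∑ᴿ (λ i → lin ψ (const (μ i) *ᴾ q i))   ≈⟨ ∑ᴿ-cong (λ i → lin-const-* ψ (μ i) (q i)) ⟩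
      ∑ᴿ (λ i → μ i *ᴿ lin ψ (q i))           ∎))
    (0≤-∑ᴿ λ i → 0≤-* (μ≥0 i) (lin-circuit≥0 (q-circuit i)))

-- By `lin-*` each product s·h is paired with `φ` by pairing s with the functional that h induces.
-- This reduces nonnegativity on all of S to one check per kind of multiplier.
lin-S≥0 : ∀ {n d f} {φ : Exponent n → ℝ} →
  (∀ {h} → h ∈ Multiplier → Admissible (λ α → lin (λ β → φ (α ⊕ β)) h)) → f ∈ S n d → 0≤ lin φ f
lin-S≥0 {f = f} {φ} admissible (k , s , h , s∈SONC , h∈M , f≈) =
  0≤-resp-≃ (≃-sym (begin
    lin φ f                          ≈⟨ lin-congʳ φ f (∑ᴾ (λ j → s j *ᴾ h j)) f≈ ⟩
    lin φ (∑ᴾ (λ j → s j *ᴾ h j))    ≈⟨ lin-∑ φ (λ j → s j *ᴾ h j) ⟩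
    ∑ᴿ (λ j → lin φ (s j *ᴾ h j))    ≈⟨ ∑ᴿ-cong (λ j → lin-* φ (s j) (h j)) ⟩
    ∑ᴿ (λ j → lin (λ α → lin (λ β → φ (α ⊕ β)) (h j)) (s j)) ∎))
  (0≤-∑ᴿ λ j → lin-SONC≥0 (admissible (h∈M j)) (s∈SONC j))

-- The separating functional

3ℚ 4ℚ : ℚ
3ℚ = + 3 / 1
4ℚ = + 4 / 1

-- Spelled as in `var`, so that `lin` of a multiplier unfolds to terms in `unit i` by computation.
unit : ∀ {n} → Fin n → Exponent n
unit i = Vec.replicate _ 0 Vec.[ i ]≔ 1

lookup-⊕ : ∀ {n} (α β : Exponent n) i → Vec.lookup (α ⊕ β) i ≡ Vec.lookup α i ℕ.+ Vec.lookup β i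
lookup-⊕ α β i = Vec.lookup-zipWith ℕ._+_ i α β

lookup-unit-≢ : ∀ {n} {i j : Fin n} → i ≢ j → Vec.lookup (unit j) i ≡ 0
lookup-unit-≢ {n} {i} i≢j = trans (Vec.lookup∘update′ i≢j (Vec.replicate n 0) 1) (Vec.lookup-replicate i 0)

Even-0 : ∀ {n} → Even (Vec.replicate n 0)
Even-0 i = subst (2 ∣_) (sym (Vec.lookup-replicate i 0)) (2 ∣0)

Even-⊕ : ∀ {n} {α β : Exponent n} → Even α → Even β → Even (α ⊕ β)
Even-⊕ {α = α} {β} α-even β-even i =
  subst (2 ∣_) (sym (lookup-⊕ α β i)) (∣m∣n⇒∣m+n (α-even i) (β-even i))

Even-⊕-cancelˡ : ∀ {n} {α β : Exponent n} → Even α → Even (α ⊕ β) → Even β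
Even-⊕-cancelˡ {α = α} {β} α-even sum-even i =
  ∣m+n∣m⇒∣n (subst (2 ∣_) (lookup-⊕ α β i) (sum-even i)) (α-even i)

Even-⊕-cancelʳ : ∀ {n} {α β : Exponent n} → Even β → Even (α ⊕ β) → Even α
Even-⊕-cancelʳ {α = α} {β} β-even sum-even i =
  ∣m+n∣m⇒∣n (subst (2 ∣_) (trans (lookup-⊕ α β i) (ℕ.+-comm (Vec.lookup α i) (Vec.lookup β i))) (sum-even i))
    (β-even i)

Even-double : ∀ {n} (α : Exponent n) → Even (α ⊕ α)
Even-double α i = subst (2 ∣_)
  (trans (cong (Vec.lookup α i ℕ.+_) (ℕ.+-identityʳ (Vec.lookup α i))) (sym (lookup-⊕ α α i)))
  (m∣m*n (Vec.lookup α i))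

¬Even-unit : ∀ {n} (i : Fin n) → ¬ Even (unit i)
¬Even-unit {n} i unit-even = contradiction
  (∣1⇒≡1 (subst (2 ∣_) (Vec.lookup∘update i (Vec.replicate n 0) 1) (unit-even i))) λ ()

-- 2²⁻ⁿ Σ_{x ∈ {±1}ⁿ} x^γ - 1, so that lin weight is the functional L.
abstract
  weight : ∀ {n} → Exponent n → ℝ
  weight γ = fromℚ (if does (even? γ) then 3ℚ else ℚ.- 1ℚ)

  weight-even : ∀ {n} {γ : Exponent n} → Even γ → weight γ ≃ fromℚ 3ℚ
  weight-even {γ = γ} γ-even rewrite dec-true (even? γ) γ-even = ≃-refl

  weight-odd : ∀ {n} {γ : Exponent n} → ¬ Even γ → weight γ ≃ fromℚ (ℚ.- 1ℚ)
  weight-odd {γ = γ} γ-odd rewrite dec-false (even? γ) γ-odd = ≃-refl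

-- Only the parity of each exponent matters on the cube. Consequently x_i² and 1 act alike, which is
-- why `cube⁺` and `cube⁻` induce the zero functional.
weight-⊕-even : ∀ {n} (α : Exponent n) {β} → Even β → weight (α ⊕ β) ≃ weight α
weight-⊕-even α {β} β-even with even? α
... | yes α-even = ≃-trans (weight-even {γ = α ⊕ β} (Even-⊕ {α = α} α-even β-even))
                           (≃-sym (weight-even α-even))
... | no  α-odd  = ≃-trans (weight-odd {γ = α ⊕ β} (α-odd ∘ Even-⊕-cancelʳ {α = α} β-even))
                           (≃-sym (weight-odd α-odd))

Admissible-resp-≃ : ∀ {n} {φ ψ : Exponent n → ℝ} → (∀ α → ψ α ≃ φ α) → Admissible φ → Admissible ψ
Admissible-resp-≃ ψ≃φ φ-admissible = record
  { level   = level
  ; level≥0 = level≥0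
  ; on-even = λ {α} α-even → ≃-trans (ψ≃φ α) (on-even α-even)
  ; ≥-level = λ {β} β-odd → 0≤-resp-≃ (+ᴿ-cong ≃-refl (≃-sym (ψ≃φ β))) (≥-level β-odd)
  ; ≤-level = λ {β} β-odd → 0≤-resp-≃ (+ᴿ-cong ≃-refl (-ᴿ-cong (≃-sym (ψ≃φ β)))) (≤-level β-odd)
  }
  where open Admissible φ-admissible

zero-admissible : ∀ {n} → Admissible {n} (λ _ → 0ᴿ)
zero-admissible = record
  { level   = 0ᴿ
  ; level≥0 = 0≤-fromℚ 0ℚ
  ; on-even = λ _ → ≃-refl
  ; ≥-level = λ _ → 0≤-+ (0≤-fromℚ 0ℚ) (0≤-fromℚ 0ℚ)
  ; ≤-level = λ _ → 0≤-resp-≃ (solve 0 (con 0ℚ := con 0ℚ :+ :- con 0ℚ) ≃-refl) (0≤-fromℚ 0ℚ)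
  }

weight-admissible : ∀ {n} → Admissible {n} weight
weight-admissible = record
  { level   = fromℚ 3ℚ
  ; level≥0 = 0≤-fromℚ 3ℚ
  ; on-even = λ {α} → weight-even {γ = α}
  ; ≥-level = λ {β} β-odd → 0≤-resp-≃
      (≃-trans (solve 0 (con (+ 2 / 1) := con 3ℚ :+ con (ℚ.- 1ℚ)) ≃-refl)
               (+ᴿ-cong ≃-refl (≃-sym (weight-odd {γ = β} β-odd))))
      (0≤-fromℚ (+ 2 / 1))
  ; ≤-level = λ {β} β-odd → 0≤-resp-≃
      (≃-trans (solve 0 (con 4ℚ := con 3ℚ :+ :- con (ℚ.- 1ℚ)) ≃-refl)
               (+ᴿ-cong ≃-refl (-ᴿ-cong (≃-sym (weight-odd {γ = β} β-odd)))))
      (0≤-fromℚ 4ℚ)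
  }

-- Here `σ` stands for the coefficient ±1 of x_i. Assuming only -1 ≤ σ ≤ 1 covers both signs at
-- once; each required inequality becomes a nonnegative combination of c, 1 and 1 ± σ.
box-admissible : ∀ {n} (i : Fin n) {c σ} → 0≤ c → 0≤ (1ᴿ +ᴿ σ) → 0≤ (1ᴿ +ᴿ -ᴿ σ) →
  Admissible (λ α → (1ᴿ +ᴿ c) *ᴿ weight α +ᴿ σ *ᴿ weight (α ⊕ unit i))
box-admissible {n} i {c} {σ} 0≤c 0≤1+σ 0≤1-σ = record
  { level   = level
  ; level≥0 = 0≤-resp-≃
      (solve 2 (λ c σ → con (+ 2 / 1) :+ con 3ℚ :* c :+ (con 1ℚ :+ :- σ)
                        := con 3ℚ :* (con 1ℚ :+ c) :+ :- σ) ≃-refl c σ)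
      (0≤-+ (0≤-+ (0≤-fromℚ (+ 2 / 1)) (0≤-* (0≤-fromℚ 3ℚ) 0≤c)) 0≤1-σ)
  ; on-even = λ {α} α-even → ≃-trans
      (values α (weight-even {γ = α} α-even)
                (weight-odd {γ = α ⊕ unit i} (¬Even-unit i ∘ Even-⊕-cancelˡ {α = α} α-even)))
      (solve 2 (λ c σ → (con 1ℚ :+ c) :* con 3ℚ :+ σ :* con (ℚ.- 1ℚ)
                        := con 3ℚ :* (con 1ℚ :+ c) :+ :- σ) ≃-refl c σ)
  ; ≥-level = λ {β} → level-≥ β
  ; ≤-level = λ {β} → level-≤ β
  }
  where
  level : ℝ
  -- The value at an even `α`: there `weight α` is 3, while `α ⊕ unit i` is not even and has weight
  -- -1.
  level = fromℚ 3ℚ *ᴿ (1ᴿ +ᴿ c) +ᴿ -ᴿ σ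

  ψ : Exponent n → ℝ
  ψ α = (1ᴿ +ᴿ c) *ᴿ weight α +ᴿ σ *ᴿ weight (α ⊕ unit i)

  values : ∀ α {u v} → weight α ≃ u → weight (α ⊕ unit i) ≃ v → ψ α ≃ (1ᴿ +ᴿ c) *ᴿ u +ᴿ σ *ᴿ v
  values α u≃ v≃ = +ᴿ-cong (*ᴿ-cong ≃-refl u≃) (*ᴿ-cong ≃-refl v≃)

  level-≥ : ∀ β → ¬ Even β → 0≤ (level +ᴿ ψ β)
  level-≥ β β-odd with even? (β ⊕ unit i)
  -- Here `β` agrees with `unit i` modulo 2, so x_i x^β is 1 on the cube and `ψ β` is -(1 + c) + 3σ.
  ... | yes even = 0≤-resp-≃
    (≃-trans
      (solve 2 (λ c σ → con (+ 2 / 1) :* (c :+ (con 1ℚ :+ σ))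
                        := (con 3ℚ :* (con 1ℚ :+ c) :+ :- σ)
                           :+ ((con 1ℚ :+ c) :* con (ℚ.- 1ℚ) :+ σ :* con 3ℚ)) ≃-refl c σ)
      (+ᴿ-cong ≃-refl (≃-sym (values β (weight-odd {γ = β} β-odd) (weight-even {γ = β ⊕ unit i} even)))))
    (0≤-* (0≤-fromℚ (+ 2 / 1)) (0≤-+ 0≤c 0≤1+σ))
  -- At c = 0 and σ = 1 this bound is an equality. With t times the mean over the cube in place of
  -- four times, it would read t - 4 ≥ 0; this is the source of the factor 4 in `weight`.
  ... | no odd = 0≤-resp-≃
    (≃-trans
      (solve 2 (λ c σ → con (+ 2 / 1) :* (c :+ (con 1ℚ :+ :- σ))
                        := (con 3ℚ :* (con 1ℚ :+ c) :+ :- σ)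
                           :+ ((con 1ℚ :+ c) :* con (ℚ.- 1ℚ) :+ σ :* con (ℚ.- 1ℚ))) ≃-refl c σ)
      (+ᴿ-cong ≃-refl (≃-sym (values β (weight-odd {γ = β} β-odd) (weight-odd {γ = β ⊕ unit i} odd)))))
    (0≤-* (0≤-fromℚ (+ 2 / 1)) (0≤-+ 0≤c 0≤1-σ))

  level-≤ : ∀ β → ¬ Even β → 0≤ (level +ᴿ -ᴿ ψ β)
  level-≤ β β-odd with even? (β ⊕ unit i)
  ... | yes even = 0≤-resp-≃
    (≃-trans
      (solve 2 (λ c σ → con 4ℚ :* (c :+ (con 1ℚ :+ :- σ))
                        := (con 3ℚ :* (con 1ℚ :+ c) :+ :- σ)
                           :+ :- ((con 1ℚ :+ c) :* con (ℚ.- 1ℚ) :+ σ :* con 3ℚ)) ≃-refl c σ)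
      (+ᴿ-cong ≃-refl (-ᴿ-cong (≃-sym (values β (weight-odd {γ = β} β-odd) (weight-even {γ = β ⊕ unit i} even))))))
    (0≤-* (0≤-fromℚ 4ℚ) (0≤-+ 0≤c 0≤1-σ))
  ... | no odd = 0≤-resp-≃
    (≃-trans
      (solve 2 (λ c σ → con 4ℚ :* (con 1ℚ :+ c)
                        := (con 3ℚ :* (con 1ℚ :+ c) :+ :- σ)
                           :+ :- ((con 1ℚ :+ c) :* con (ℚ.- 1ℚ) :+ σ :* con (ℚ.- 1ℚ))) ≃-refl c σ)
      (+ᴿ-cong ≃-refl (-ᴿ-cong (≃-sym (values β (weight-odd {γ = β} β-odd) (weight-odd {γ = β ⊕ unit i} odd))))))
    (0≤-* (0≤-fromℚ 4ℚ) (0≤-+ (0≤-fromℚ 1ℚ) 0≤c))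

multiplier-admissible : ∀ {n} {h : Poly n} → h ∈ Multiplier →
  Admissible (λ α → lin (λ β → weight (α ⊕ β)) h)
multiplier-admissible one = Admissible-resp-≃
  (λ α → begin
    1ᴿ *ᴿ weight (α ⊕ Vec.replicate _ 0) +ᴿ 0ᴿ
      ≈⟨ solve 1 (λ x → con 1ℚ :* x :+ con 0ℚ := x) ≃-refl (weight (α ⊕ Vec.replicate _ 0)) ⟩
    weight (α ⊕ Vec.replicate _ 0)
      ≈⟨ weight-⊕-even α Even-0 ⟩
    weight α ∎)
  weight-admissible
multiplier-admissible (cube⁺ i) = Admissible-resp-≃
  (λ α → begin
    1ᴿ *ᴿ 1ᴿ *ᴿ weight (α ⊕ (unit i ⊕ unit i)) +ᴿ (-ᴿ 1ᴿ *ᴿ weight (α ⊕ Vec.replicate _ 0) +ᴿ 0ᴿ)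
      ≈⟨ +ᴿ-cong (*ᴿ-cong ≃-refl (weight-⊕-even α (Even-double (unit i))))
                 (+ᴿ-cong (*ᴿ-cong ≃-refl (weight-⊕-even α Even-0)) ≃-refl) ⟩
    1ᴿ *ᴿ 1ᴿ *ᴿ weight α +ᴿ (-ᴿ 1ᴿ *ᴿ weight α +ᴿ 0ᴿ)
      ≈⟨ solve 1 (λ x → con 1ℚ :* con 1ℚ :* x :+ (:- con 1ℚ :* x :+ con 0ℚ) := con 0ℚ) ≃-refl (weight α) ⟩
    0ᴿ ∎)
  zero-admissible
multiplier-admissible (cube⁻ i) = Admissible-resp-≃
  (λ α → begin
    -ᴿ (1ᴿ *ᴿ 1ᴿ) *ᴿ weight (α ⊕ (unit i ⊕ unit i)) +ᴿ (-ᴿ (-ᴿ 1ᴿ) *ᴿ weight (α ⊕ Vec.replicate _ 0) +ᴿ 0ᴿ)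
      ≈⟨ +ᴿ-cong (*ᴿ-cong ≃-refl (weight-⊕-even α (Even-double (unit i))))
                 (+ᴿ-cong (*ᴿ-cong ≃-refl (weight-⊕-even α Even-0)) ≃-refl) ⟩
    -ᴿ (1ᴿ *ᴿ 1ᴿ) *ᴿ weight α +ᴿ (-ᴿ (-ᴿ 1ᴿ) *ᴿ weight α +ᴿ 0ᴿ)
      ≈⟨ solve 1 (λ x → :- (con 1ℚ :* con 1ℚ) :* x :+ (:- (:- con 1ℚ) :* x :+ con 0ℚ) := con 0ℚ) ≃-refl (weight α) ⟩
    0ᴿ ∎)
  zero-admissible
multiplier-admissible (box⁺ i c 0≤c) = Admissible-resp-≃
  (λ α → +ᴿ-cong (*ᴿ-cong ≃-refl (weight-⊕-even α Even-0))
    (solve 1 (λ x → x :+ con 0ℚ := x) ≃-refl (1ᴿ *ᴿ weight (α ⊕ unit i))))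
  -- The coefficient of x_i is `σ` = 1, so 1 + σ = 2 and 1 - σ = 0; for `box⁻` the two are
  -- exchanged.
  (box-admissible i 0≤c (0≤-+ (0≤-fromℚ 1ℚ) (0≤-fromℚ 1ℚ))
    (0≤-resp-≃ (solve 0 (con 0ℚ := con 1ℚ :+ :- con 1ℚ) ≃-refl) (0≤-fromℚ 0ℚ)))
multiplier-admissible (box⁻ i c 0≤c) = Admissible-resp-≃
  (λ α → +ᴿ-cong (*ᴿ-cong ≃-refl (weight-⊕-even α Even-0))
    (solve 1 (λ x → x :+ con 0ℚ := x) ≃-refl (-ᴿ 1ᴿ *ᴿ weight (α ⊕ unit i))))
  (box-admissible i 0≤c
    (0≤-resp-≃ (solve 0 (con 0ℚ := con 1ℚ :+ :- con 1ℚ) ≃-refl) (0≤-fromℚ 0ℚ))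
    (0≤-resp-≃ (solve 0 (con (+ 2 / 1) := con 1ℚ :+ :- (:- con 1ℚ)) ≃-refl) (0≤-fromℚ (+ 2 / 1))))

-- Its value at f_a

-- The operator `_/_` reduces to lowest terms and does not compute on variables. Identities between
-- casts are therefore proved for unnormalised rationals, by cross-multiplication.
toℚᵘ-/ : ∀ i d → ℚ.toℚᵘ (i / suc d) ℚᵘ.≃ mkℚᵘ i d
toℚᵘ-/ i d = ℚ.toℚᵘ-fromℚᵘ (mkℚᵘ i d)

/-cancel : ∀ p d .{{_ : ℕ.NonZero d}} → (+ p / d) ℚ.* (+ d / 1) ≡ + p / 1
/-cancel p (suc d) = ℚ.toℚᵘ-injective (ℚᵘ.≃-trans
  (ℚ.toℚᵘ-homo-* (+ p / suc d) (+ suc d / 1))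
  (ℚᵘ.≃-trans (ℚᵘ.*-cong (toℚᵘ-/ (+ p) d) (toℚᵘ-/ (+ suc d) 0))
  (ℚᵘ.≃-trans (*≡* (ℤ.*-assoc (+ p) (+ suc d) (+ 1)))
  (ℚᵘ.≃-sym (toℚᵘ-/ (+ p) 0)))))

0≤p-q⇒q≤p : ∀ {p q} → 0ℚ ℚ.≤ p ℚ.- q → q ℚ.≤ p
0≤p-q⇒q≤p {p} {q} 0≤p-q =
  subst (ℚ._≤ p) (ℚ.+-identityʳ q) (subst (q ℚ.+ 0ℚ ℚ.≤_) (cancel p q) (ℚ.+-monoʳ-≤ q 0≤p-q))

fromℕ-+ : ∀ m n → fromℕ (m ℕ.+ n) ≃ fromℕ m +ᴿ fromℕ n
fromℕ-+ m n = pointwise λ _ → ℚ.toℚᵘ-injective (ℚᵘ.≃-sym (ℚᵘ.≃-trans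
  (ℚ.toℚᵘ-homo-+ (+ m / 1) (+ n / 1))
  (ℚᵘ.≃-trans (ℚᵘ.+-cong (toℚᵘ-/ (+ m) 0) (toℚᵘ-/ (+ n) 0))
  (ℚᵘ.≃-trans (*≡* (cong (ℤ._* + 1) (cong₂ ℤ._+_ (ℤ.*-identityʳ (+ m)) (ℤ.*-identityʳ (+ n)))))
  (ℚᵘ.≃-sym (toℚᵘ-/ (+ (m ℕ.+ n)) 0))))))

fromℕ-* : ∀ m n → fromℕ (m ℕ.* n) ≃ fromℕ m *ᴿ fromℕ n
fromℕ-* m n = pointwise λ _ → ℚ.toℚᵘ-injective (ℚᵘ.≃-sym (ℚᵘ.≃-trans
  (ℚ.toℚᵘ-homo-* (+ m / 1) (+ n / 1))
  (ℚᵘ.≃-trans (ℚᵘ.*-cong (toℚᵘ-/ (+ m) 0) (toℚᵘ-/ (+ n) 0))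
  (ℚᵘ.≃-trans (*≡* (cong (ℤ._* + 1) (sym (ℤ.pos-* m n))))
  (ℚᵘ.≃-sym (toℚᵘ-/ (+ (m ℕ.* n)) 0))))))

-- Spelled as in `f[_]`, so that `∏ᴾ factor` is the product there by definition.
factor : ∀ {n} → Fin n → Poly n
factor i = const ½ᴿ *ᴾ (var i +ᴾ const 1ᴿ)

-- Multiplication by ½(x_i + 1) averages the functional shifted by `unit i` with the unshifted one.
lin-factor-* : ∀ {n} (φ : Exponent n → ℝ) i p →
  lin φ (factor i *ᴾ p) ≃ ½ᴿ *ᴿ (lin (λ β → φ (unit i ⊕ β)) p +ᴿ lin φ p)
lin-factor-* {n} φ i p = begin
  lin φ (factor i *ᴾ p)
    ≈⟨ lin-* φ (factor i) p ⟩
  lin shifted (factor i)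
    ≈⟨ lin-const-* shifted ½ᴿ (var i +ᴾ const 1ᴿ) ⟩
  ½ᴿ *ᴿ (1ᴿ *ᴿ shifted (unit i) +ᴿ (1ᴿ *ᴿ shifted (Vec.replicate n 0) +ᴿ 0ᴿ))
    ≈⟨ solve 2 (λ x y → con ½ :* (con 1ℚ :* x :+ (con 1ℚ :* y :+ con 0ℚ)) := con ½ :* (x :+ y))
         ≃-refl (shifted (unit i)) (shifted (Vec.replicate n 0)) ⟩
  ½ᴿ *ᴿ (shifted (unit i) +ᴿ shifted (Vec.replicate n 0))
    ≈⟨ *ᴿ-cong ≃-refl (+ᴿ-cong ≃-refl
         (lin-congˡ (λ β → ≃-reflexive (cong φ (⊕-identityˡ β))) p)) ⟩
  ½ᴿ *ᴿ (shifted (unit i) +ᴿ lin φ p) ∎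
  where
  shifted : Exponent n → ℝ
  shifted α = lin (λ β → φ (α ⊕ β)) p

-- Expanding one factor ½(x_i + 1) shifts α by unit i or by 0, and the shift by unit i makes α odd.
lin-weight-∏ : ∀ {n} k (ι : Fin k → Fin n) → Injective _≡_ _≡_ ι →
  ∀ α → (∀ j → Vec.lookup α (ι j) ≡ 0) →
  fromℕ (2 ℕ.^ k) *ᴿ lin (λ β → weight (α ⊕ β)) (∏ᴾ (factor ∘ ι))
    ≃ weight α +ᴿ 1ᴿ +ᴿ -ᴿ fromℕ (2 ℕ.^ k)
lin-weight-∏ {n} zero ι ι-injective α α∘ι≡0 = begin
  1ᴿ *ᴿ (1ᴿ *ᴿ weight (α ⊕ Vec.replicate n 0) +ᴿ 0ᴿ)
    ≈⟨ *ᴿ-cong ≃-refl (+ᴿ-cong (*ᴿ-cong ≃-refl (weight-⊕-even α Even-0)) ≃-refl) ⟩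
  1ᴿ *ᴿ (1ᴿ *ᴿ weight α +ᴿ 0ᴿ)
    ≈⟨ solve 1 (λ x → con 1ℚ :* (con 1ℚ :* x :+ con 0ℚ) := x :+ con 1ℚ :+ :- con 1ℚ) ≃-refl (weight α) ⟩
  weight α +ᴿ 1ᴿ +ᴿ -ᴿ 1ᴿ ∎
lin-weight-∏ {n} (suc k) ι ι-injective α α∘ι≡0 = begin
  fromℕ (2 ℕ.* 2 ℕ.^ k) *ᴿ lin (λ β → weight (α ⊕ β)) (factor i *ᴾ rest)
    ≈⟨ *ᴿ-cong (fromℕ-* 2 (2 ℕ.^ k)) (lin-factor-* (λ β → weight (α ⊕ β)) i rest) ⟩
  fromℕ 2 *ᴿ T *ᴿ (½ᴿ *ᴿ (lin (λ β → weight (α ⊕ (unit i ⊕ β))) rest +ᴿ lin (λ β → weight (α ⊕ β)) rest))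
    ≈⟨ *ᴿ-cong ≃-refl (*ᴿ-cong ≃-refl (+ᴿ-cong (lin-congˡ reassociate rest) ≃-refl)) ⟩
  fromℕ 2 *ᴿ T *ᴿ (½ᴿ *ᴿ (lin (λ β → weight (α ⊕ unit i ⊕ β)) rest +ᴿ lin (λ β → weight (α ⊕ β)) rest))
    ≈⟨ solve 3 (λ T x y → con (+ 2 / 1) :* T :* (con ½ :* (x :+ y)) := T :* x :+ T :* y) ≃-refl T _ _ ⟩
  T *ᴿ lin (λ β → weight (α ⊕ unit i ⊕ β)) rest +ᴿ T *ᴿ lin (λ β → weight (α ⊕ β)) rest
    -- Both induction hypotheses use the tail of `ι`; an arbitrary injection into a fixed `Fin n`
    -- keeps the exponents in the same space. Injectivity ensures that `α ⊕ unit i` still vanishes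
    -- at the remaining variables.
    ≈⟨ +ᴿ-cong (lin-weight-∏ k (ι ∘ suc) ι∘suc-injective (α ⊕ unit i) vanishes)
               (lin-weight-∏ k (ι ∘ suc) ι∘suc-injective α (α∘ι≡0 ∘ suc)) ⟩
  (weight (α ⊕ unit i) +ᴿ 1ᴿ +ᴿ -ᴿ T) +ᴿ (weight α +ᴿ 1ᴿ +ᴿ -ᴿ T)
    -- Since -1 + 1 = 0, the shifted half leaves only -`T`: each of its `T` monomials has weight -1.
    ≈⟨ +ᴿ-cong (+ᴿ-cong (+ᴿ-cong (weight-odd odd) ≃-refl) ≃-refl) ≃-refl ⟩
  (fromℚ (ℚ.- 1ℚ) +ᴿ 1ᴿ +ᴿ -ᴿ T) +ᴿ (weight α +ᴿ 1ᴿ +ᴿ -ᴿ T)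
    ≈⟨ solve 2 (λ T w → (con (ℚ.- 1ℚ) :+ con 1ℚ :+ :- T) :+ (w :+ con 1ℚ :+ :- T)
                        := w :+ con 1ℚ :+ :- (con (+ 2 / 1) :* T)) ≃-refl T (weight α) ⟩
  weight α +ᴿ 1ᴿ +ᴿ -ᴿ (fromℕ 2 *ᴿ T)
    ≈⟨ +ᴿ-cong ≃-refl (-ᴿ-cong (≃-sym (fromℕ-* 2 (2 ℕ.^ k)))) ⟩
  weight α +ᴿ 1ᴿ +ᴿ -ᴿ fromℕ (2 ℕ.* 2 ℕ.^ k) ∎
  where
  i    = ι zero
  rest = ∏ᴾ (factor ∘ ι ∘ suc)
  T    = fromℕ (2 ℕ.^ k)

  ι∘suc-injective : Injective _≡_ _≡_ (ι ∘ suc)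
  ι∘suc-injective = suc-injective ∘ ι-injective

  reassociate : ∀ β → weight (α ⊕ (unit i ⊕ β)) ≃ weight (α ⊕ unit i ⊕ β)
  reassociate β = ≃-reflexive (cong weight (sym (Vec.zipWith-assoc ℕ.+-assoc α (unit i) β)))

  vanishes : ∀ j → Vec.lookup (α ⊕ unit i) (ι (suc j)) ≡ 0
  vanishes j = trans (lookup-⊕ α (unit i) (ι (suc j)))
    (cong₂ ℕ._+_ (α∘ι≡0 (suc j)) (lookup-unit-≢ λ eq → 0≢1+n (sym (ι-injective eq))))

  odd : ¬ Even (α ⊕ unit i)
  odd even = contradiction
    (∣1⇒≡1 (subst (2 ∣_) (trans (lookup-⊕ α (unit i) i)
      (cong₂ ℕ._+_ (α∘ι≡0 zero) (Vec.lookup∘update i (Vec.replicate n 0) 1))) (even i))) λ ()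

-- The product is `lin-weight-∏` for the identity injection and exponent 0, whose weight 3 yields 4
-- - 2ⁿ; the summand 1 contributes 3.
lin-weight-f : ∀ {n} a → fromℕ (2 ℕ.^ n) *ᴿ lin weight (f[_] {n} a)
  ≃ (fromℕ a +ᴿ -ᴿ 1ᴿ) *ᴿ (fromℚ 4ℚ +ᴿ -ᴿ fromℕ (2 ℕ.^ n)) +ᴿ fromℚ 3ℚ *ᴿ fromℕ (2 ℕ.^ n)
lin-weight-f {n} a = begin
  T *ᴿ lin weight (const a-1 *ᴾ Q +ᴾ const 1ᴿ)
    ≈⟨ *ᴿ-cong ≃-refl (lin-++ weight (const a-1 *ᴾ Q) (const 1ᴿ)) ⟩
  T *ᴿ (lin weight (const a-1 *ᴾ Q) +ᴿ lin weight (const 1ᴿ))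
    ≈⟨ *ᴿ-cong ≃-refl (+ᴿ-cong
         (≃-trans (lin-const-* weight a-1 Q) (*ᴿ-cong ≃-refl (lin-congˡ shift-by-0 Q)))
         (≃-trans (lin-monomial weight 1ᴿ 0ᴱ) (*ᴿ-cong ≃-refl (weight-even {γ = 0ᴱ} Even-0)))) ⟩
  T *ᴿ (a-1 *ᴿ lin (λ β → weight (0ᴱ ⊕ β)) Q +ᴿ 1ᴿ *ᴿ fromℚ 3ℚ)
    ≈⟨ solve 3 (λ T b x → T :* (b :* x :+ con 1ℚ :* con 3ℚ) := b :* (T :* x) :+ con 3ℚ :* T) ≃-refl T a-1 _ ⟩
  a-1 *ᴿ (T *ᴿ lin (λ β → weight (0ᴱ ⊕ β)) Q) +ᴿ fromℚ 3ℚ *ᴿ T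
    ≈⟨ +ᴿ-cong (*ᴿ-cong ≃-refl
         (≃-trans (lin-weight-∏ n id id 0ᴱ (λ j → Vec.lookup-replicate j 0))
                  (+ᴿ-cong (+ᴿ-cong (weight-even {γ = 0ᴱ} Even-0) ≃-refl) ≃-refl))) ≃-refl ⟩
  a-1 *ᴿ (fromℚ 3ℚ +ᴿ 1ᴿ +ᴿ -ᴿ T) +ᴿ fromℚ 3ℚ *ᴿ T
    ≈⟨ solve 2 (λ b T → b :* (con 3ℚ :+ con 1ℚ :+ :- T) :+ con 3ℚ :* T
                        := b :* (con 4ℚ :+ :- T) :+ con 3ℚ :* T) ≃-refl a-1 T ⟩
  a-1 *ᴿ (fromℚ 4ℚ +ᴿ -ᴿ T) +ᴿ fromℚ 3ℚ *ᴿ T ∎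
  where
  T   = fromℕ (2 ℕ.^ n)
  Q   = ∏ᴾ (factor {n})
  a-1 = fromℕ a +ᴿ -ᴿ 1ᴿ
  0ᴱ  = Vec.replicate n 0

  shift-by-0 : ∀ β → weight β ≃ weight (0ᴱ ⊕ β)
  shift-by-0 β = ≃-reflexive (cong weight (sym (⊕-identityˡ β)))

-- The factor 2ⁿ/4 clears denominators. With P = 2ⁿ - 1 and D = 2ⁿ⁻² - 1 the threshold is P/D, so
-- the sign of the result compares it with `a`. The two equations avoid truncated subtraction.
lin-weight-f-scaled : ∀ {n} a P D → 2 ℕ.^ n ≡ suc P → 2 ℕ.^ n ≡ 4 ℕ.* suc D →
  fromℚ (+ 1 / 4) *ᴿ (fromℕ (2 ℕ.^ n) *ᴿ lin weight (f[_] {n} a))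
    ≃ fromℕ P +ᴿ -ᴿ (fromℕ a *ᴿ fromℕ D)
lin-weight-f-scaled {n} a P D T≡1+P T≡4+4D = begin
  fromℚ (+ 1 / 4) *ᴿ (T *ᴿ lin weight (f[_] {n} a))
    ≈⟨ *ᴿ-cong ≃-refl (lin-weight-f {n} a) ⟩
  fromℚ (+ 1 / 4) *ᴿ ((fromℕ a +ᴿ -ᴿ 1ᴿ) *ᴿ (fromℚ 4ℚ +ᴿ -ᴿ T) +ᴿ fromℚ 3ℚ *ᴿ T)
    ≈⟨ solve 2 (λ a T → con (+ 1 / 4) :* ((a :+ :- con 1ℚ) :* (con 4ℚ :+ :- T) :+ con 3ℚ :* T)
                        := con (+ 1 / 4) :* (a :* (con 4ℚ :+ :- T) :+ :- con 4ℚ) :+ T)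
         ≃-refl (fromℕ a) T ⟩
  fromℚ (+ 1 / 4) *ᴿ (fromℕ a *ᴿ (fromℚ 4ℚ +ᴿ -ᴿ T) +ᴿ -ᴿ fromℚ 4ℚ) +ᴿ T
    -- The inner `T` becomes 4 + 4D and the outer one 1 + P, so that the constants -1 and 1 cancel.
    ≈⟨ +ᴿ-cong (*ᴿ-cong ≃-refl (+ᴿ-cong (*ᴿ-cong ≃-refl (+ᴿ-cong ≃-refl (-ᴿ-cong T≃4+4D))) ≃-refl)) T≃1+P ⟩
  fromℚ (+ 1 / 4) *ᴿ (fromℕ a *ᴿ (fromℚ 4ℚ +ᴿ -ᴿ (fromℚ 4ℚ *ᴿ (1ᴿ +ᴿ fromℕ D))) +ᴿ -ᴿ fromℚ 4ℚ) +ᴿ (1ᴿ +ᴿ fromℕ P)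
    ≈⟨ solve 3 (λ a P D →
         con (+ 1 / 4) :* (a :* (con 4ℚ :+ :- (con 4ℚ :* (con 1ℚ :+ D))) :+ :- con 4ℚ) :+ (con 1ℚ :+ P)
         := P :+ :- (a :* D)) ≃-refl (fromℕ a) (fromℕ P) (fromℕ D) ⟩
  fromℕ P +ᴿ -ᴿ (fromℕ a *ᴿ fromℕ D) ∎
  where
  T = fromℕ (2 ℕ.^ n)

  T≃1+P : T ≃ 1ᴿ +ᴿ fromℕ P
  T≃1+P = ≃-trans (≃-reflexive (cong fromℕ T≡1+P)) (fromℕ-+ 1 P)

  T≃4+4D : T ≃ fromℚ 4ℚ *ᴿ (1ᴿ +ᴿ fromℕ D)
  T≃4+4D = ≃-trans (≃-reflexive (cong fromℕ T≡4+4D))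
    (≃-trans (fromℕ-* 4 (suc D)) (*ᴿ-cong ≃-refl (fromℕ-+ 1 D)))

theorem5p1 : (n : ℕ) (3≤n : 3 ≤ n) (a : ℕ) → threshold n 3≤n < (+ a) / 1 →
    (d : ℕ) → ¬ (f[_] {n} a ∈ S n d)
-- Exposing three successors makes `n ∸ 2` reduce to `suc m`, so the denominator of the threshold is
-- `D`. The contradiction is P < a D ≤ P.
theorem5p1 n@(suc (suc (suc m))) 3≤n@(s≤s (s≤s (s≤s _))) a threshold<a d f∈S =
  ℚ.<-irrefl refl (ℚ.<-≤-trans P<aD aD≤P)
  where
  P D : ℕ
  P = 2 ℕ.^ n ℕ.∸ 1
  D = 2 ℕ.^ suc m ℕ.∸ 1

  instance
    D≢0 : ℕ.NonZero D
    D≢0 = 2ⁿ⁻²-1≢0 3≤n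

  T≡1+P : 2 ℕ.^ n ≡ suc P
  T≡1+P = sym (ℕ.suc-pred (2 ℕ.^ n) {{ℕ.m^n≢0 2 n}})

  T≡4+4D : 2 ℕ.^ n ≡ 4 ℕ.* suc D
  T≡4+4D = trans (sym (ℕ.*-assoc 2 2 (2 ℕ.^ suc m)))
    (cong (4 ℕ.*_) (sym (ℕ.suc-pred (2 ℕ.^ suc m) {{ℕ.m^n≢0 2 (suc m)}})))

  P<aD : + P / 1 < (+ a / 1) ℚ.* (+ D / 1)
  P<aD = subst (ℚ._< (+ a / 1) ℚ.* (+ D / 1)) (/-cancel P D)
    (ℚ.*-monoˡ-<-pos (+ D / 1) {{ℚ.normalize-pos D 1}} threshold<a)

  aD≤P : (+ a / 1) ℚ.* (+ D / 1) ℚ.≤ + P / 1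
  -- Nonnegativity of L(f_a), scaled by 2ⁿ/4, concerns a real equal to the rational P - a D, and so
  -- descends to `ℚ`.
  aD≤P = 0≤p-q⇒q≤p (0≤-fromℚ⁻¹ (+ P / 1 ℚ.- (+ a / 1) ℚ.* (+ D / 1)) (0≤-resp-≃
    (≃-trans (lin-weight-f-scaled {n} a P D T≡1+P T≡4+4D) (pointwise λ _ → refl))
    (0≤-* (0≤-fromℚ (+ 1 / 4)) (0≤-* (0≤-fromℚ (+ (2 ℕ.^ n) / 1) {{ℚ.normalize-nonNeg (2 ℕ.^ n) 1}})
      (lin-S≥0 {n} {d} {f[ a ]} {weight} multiplier-admissible f∈S)))))
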